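{- Let $k \geq 4$ be fixed and $\ell \geq 60k+12$. Then for all sufficiently large $n$, $$sat(K_k^n,C_{\ell}) \leq k(n-1) + 6 \left\lceil \frac{\ell}{5} \right\rceil.$$ Moreover, for $\ell \ge 60\cdot 3+12$ and all sufficiently large $n$, $sat(K_3^n, C_{\ell}) \leq 3n + 13 \left\lceil \frac{\ell}{5} \right\rceil$.
   Context: All graphs are finite, simple and undirected. $K_k^n$ denotes the complete $k$-partite graph with exactly $n$ vertices in each of its $k$ parts. $C_\ell$ denotes the cycle on $\ell$ vertices. For graphs $G$ and $F$, a spanning subgraph $H$ of $G$ is $F$-saturated relative to $G$ if $H$ contains no copy of $F$ but $H+e$ contains a copy of $F$ for every $e\in E(G)\setminus E(H)$; $sat(G,F)$ is the minimum number of edges of a graph that is $F$-saturated relative to $G$. -}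

module Defs where

open import Data.Nat using (ℕ; zero; suc; _+_; _*_; _≤_)
open import Data.Nat.DivMod using (_/_)
open import Data.Fin using (Fin; toℕ) renaming (_≟_ to _≟ᶠ_)
open import Data.Bool using (Bool; true; false; _∨_; _∧_; if_then_else_)
open import Data.List using (List; map; concatMap)
open import Data.Nat.ListAction using (sum)
open import Data.List.Base using (allFin)
open import Data.Product using (Σ; _×_; _,_; proj₁)
open import Data.Product.Properties using (≡-dec)
open import Data.Sum using (_⊎_)
open import Function.Definitions using (Injective)
open import Relation.Binary.PropositionalEquality using (_≡_; _≢_)
open import Relation.Nullary.Decidable using (⌊_⌋; Dec)
open import Data.Empty using (⊥)

-- Vertex set of K_k^n: part index × index within the part.
V : ℕ → ℕ → Set
V k n = Fin k × Fin n

_≟V_ : ∀ {k n} (u v : V k n) → Dec (u ≡ v)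
_≟V_ = ≡-dec _≟ᶠ_ _≟ᶠ_

KAdj : ∀ {k n} → V k n → V k n → Set
KAdj u v = proj₁ u ≢ proj₁ v

Graph : ℕ → ℕ → Set
Graph k n = V k n → V k n → Bool

-- H is a simple spanning subgraph of K_k^n: symmetric, and every edge is
-- an edge of K_k^n (this also forces irreflexivity).
SpanningSub : ∀ {k n} → Graph k n → Set
SpanningSub {k} {n} H =
  (∀ (u v : V k n) → H u v ≡ H v u) × (∀ (u v : V k n) → H u v ≡ true → KAdj u v)

allV : ∀ k n → List (V k n)
allV k n = concatMap (λ i → map (λ a → (i , a)) (allFin n)) (allFin k)

orderedEdgeCount : ∀ {k n} → Graph k n → ℕ
orderedEdgeCount {k} {n} H =
  sum (map (λ u → sum (map (λ v → if H u v then 1 else 0) (allV k n))) (allV k n))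

edgeCount : ∀ {k n} → Graph k n → ℕ
edgeCount H = orderedEdgeCount H / 2

addEdge : ∀ {k n} → Graph k n → V k n → V k n → Graph k n
addEdge H u v x y =
  H x y ∨ (⌊ x ≟V u ⌋ ∧ ⌊ y ≟V v ⌋) ∨ (⌊ x ≟V v ⌋ ∧ ⌊ y ≟V u ⌋)

CycSucc : ∀ {ℓ} → Fin ℓ → Fin ℓ → Set
CycSucc {ℓ} i j = (suc (toℕ i) ≡ toℕ j) ⊎ ((suc (toℕ i) ≡ ℓ) × (toℕ j ≡ 0))

ContainsCycle : ∀ {k n} → ℕ → Graph k n → Set
ContainsCycle {k} {n} ℓ H =
  Σ (Fin ℓ → V k n) λ f → Injective _≡_ _≡_ f × (∀ i j → CycSucc i j → H (f i) (f j) ≡ true)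

CycleSaturated : ∀ k n → ℕ → Graph k n → Set
CycleSaturated k n ℓ H =
  SpanningSub H
  × (ContainsCycle ℓ H → ⊥)
  × (∀ (u v : V k n) → KAdj u v → H u v ≡ false → ContainsCycle ℓ (addEdge H u v))

-- sat(K_k^n, C_ℓ) ≤ b  (sat is the minimum edge count of such an H)
SatLe : ℕ → ℕ → ℕ → ℕ → Set
SatLe k n ℓ b = Σ (Graph k n) λ H → CycleSaturated k n ℓ H × (edgeCount H ≤ b)

ceil5 : ℕ → ℕ
ceil5 m = (m + 4) / 5

-- The saturated graph is a ladder with columns 0, …, M whose rungs are completed to
-- triangles by third vertices yy c; all other vertices are leaves, those of one part
-- hanging at one common vertex.  The rails and the third vertices of the two end
-- columns number ℓ - 1.  A cycle through an inner yy c uses both rail vertices of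
-- column c, so it stays on one side of that column, and yy c can be charged to the
-- end of the ladder that the cycle misses; hence cycles have at most ℓ - 1 vertices.
-- A path from column i to column j > i is less restricted: it covers the columns ≤ i
-- along one rail and back along the other, crosses the columns in between one by
-- one through their rungs, and covers the columns ≥ j like the first ones.  This
-- uses the same ℓ - 1 vertices, and it has room for exactly one more: an endpoint
-- that is a leaf or an inner yy c, or else some yy c strictly between the endpoints.
-- Nonadjacent vertices are therefore joined by paths with ℓ vertices.  Parities
-- match because the rails are properly 2-coloured, except near special columns,
-- where consecutive columns are completely joined.
module Submission where

open import Defs
open import Data.Bool using (Bool; true; false; not; _∧_; _∨_; _xor_; if_then_else_; T)
open import Data.Bool.Properties using (T-≡; ¬-not; not-involutive; ∨-comm; ∨-zeroʳ) renaming (_≟_ to _≟ᵇ_)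
open import Data.Empty using (⊥; ⊥-elim)
open import Data.Fin using (Fin; fromℕ<; toℕ) renaming (zero to fz; suc to fs)
open import Data.Fin.Properties using (pigeonhole; toℕ-fromℕ<; toℕ-injective; toℕ<n)
open import Data.List using (List; []; _∷_; _++_; allFin; concatMap; length; lookup; map; tabulate)
open import Data.List.Properties using (length-++; map-++; map-tabulate; map-∘)
open import Data.List.Membership.Propositional using (_∈_)
open import Data.List.Membership.Propositional.Properties using (∈-++⁺ʳ; ∈-++⁺ˡ; ∈-++⁻; ∈-lookup)
open import Data.List.Relation.Unary.All as All using (All; []; _∷_)
import Data.List.Relation.Unary.All.Properties as All
open import Data.List.Relation.Unary.AllPairs using ([]; _∷_)
open import Data.List.Relation.Unary.Any using (here; there)
open import Data.List.Relation.Unary.Unique.Propositional using (Unique)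
import Data.List.Relation.Unary.Unique.Propositional.Properties as Unique
open import Data.Nat
open import Data.Nat.DivMod
open import Data.Nat.ListAction using (sum)
open import Data.Nat.ListAction.Properties using (sum-++)
open import Data.Nat.Properties
open import Data.Nat.Solver using (module +-*-Solver)
open import Data.Product using (Σ; _×_; _,_; proj₁; proj₂)
open import Data.Sum as Sum using (_⊎_; inj₁; inj₂; swap)
open import Data.Unit using (⊤; tt)
open import Function using (Equivalence; _∘_; id)
open import Relation.Binary.Definitions using (tri<; tri≈; tri>)
open import Relation.Binary.PropositionalEquality
open import Relation.Nullary using (Dec; yes; no; ¬_)
open import Relation.Nullary.Decidable using (⌊_⌋; map′; _×-dec_)
open +-*-Solver using (solve; _:+_; _:*_; _:=_; con)

-- Leaves of different parts need different hosts, since two leaves at one vertex are joined only by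
-- a path with three vertices. Column 0 has hosts for three parts; each further part gets a special
-- column. There the leaves hang at one rail vertex, the other rail vertex lies in their own part
-- and a third vertex is absent, so a leaf has nothing to be joined to inside its column. Near
-- special columns, and at column 0 because `yy 0` is joined to all of column 1, a path may leave on
-- either rail. Elsewhere the exit is forced, but then only plain columns follow, and nonadjacent
-- rail vertices of different parts have just the parity that a sweep needs. If both endpoints are
-- additional vertices, the left half of the path drops a vertex of column 0. Hence each half
-- carries a flag for one vertex more, and the two flags are complementary. `ε` says whether `yy M`
-- exists; this serves both parities of ℓ. A plain inner column has two rail edges, a rung and two
-- triangle edges for three vertices, so it exceeds one edge per vertex by two. It also contributes
-- two vertices to ℓ, so the total surplus is about ℓ plus a multiple of k.

[_]? : Bool → ℕ
[ b ]? = if b then 1 else 0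

-- Finite sums over lists and over the vertex set.

module _ {X : Set} where

  ∑ : List X → (X → ℕ) → ℕ
  ∑ xs f = sum (map f xs)

  ∑-mono : ∀ xs {f g : X → ℕ} → (∀ x → f x ≤ g x) → ∑ xs f ≤ ∑ xs g
  ∑-mono []       _   = z≤n
  ∑-mono (x ∷ xs) f≤g = +-mono-≤ (f≤g x) (∑-mono xs f≤g)

  ∑-cong : ∀ xs {f g : X → ℕ} → (∀ x → f x ≡ g x) → ∑ xs f ≡ ∑ xs g
  ∑-cong []       _   = refl
  ∑-cong (x ∷ xs) f≡g = cong₂ _+_ (f≡g x) (∑-cong xs f≡g)

  ∑-+ : ∀ xs (f g : X → ℕ) → ∑ xs (λ x → f x + g x) ≡ ∑ xs f + ∑ xs g
  ∑-+ []       f g = refl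
  ∑-+ (x ∷ xs) f g rewrite ∑-+ xs f g =
    solve 4 (λ a b c d → (a :+ b) :+ (c :+ d) := (a :+ c) :+ (b :+ d)) refl (f x) (g x) (∑ xs f) (∑ xs g)

  ∑-*ʳ : ∀ xs (f : X → ℕ) w → ∑ xs (λ x → f x * w) ≡ ∑ xs f * w
  ∑-*ʳ []       f w = refl
  ∑-*ʳ (x ∷ xs) f w rewrite ∑-*ʳ xs f w = sym (*-distribʳ-+ w (f x) (∑ xs f))

  ∑-*ˡ : ∀ xs (f : X → ℕ) w → ∑ xs (λ x → w * f x) ≡ w * ∑ xs f
  ∑-*ˡ xs f w = trans (∑-cong xs (λ x → *-comm w (f x))) (trans (∑-*ʳ xs f w) (*-comm (∑ xs f) w))

  ∑-const : ∀ xs w → ∑ xs (λ _ → w) ≡ length xs * w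
  ∑-const []       w = refl
  ∑-const (x ∷ xs) w = cong (w +_) (∑-const xs w)

∑-swap : ∀ {X Y : Set} (xs : List X) (ys : List Y) (f : X → Y → ℕ) →
         ∑ xs (λ x → ∑ ys (f x)) ≡ ∑ ys (λ y → ∑ xs (λ x → f x y))
∑-swap []       ys f = sym (trans (∑-const ys 0) (*-zeroʳ (length ys)))
∑-swap (x ∷ xs) ys f rewrite ∑-swap xs ys f = sym (∑-+ ys (f x) (λ y → ∑ xs (λ z → f z y)))

∑-allV : ∀ k n (f : V k n → ℕ) →
         ∑ (allV k n) f ≡ ∑ (allFin k) (λ i → ∑ (allFin n) (λ a → f (i , a)))
∑-allV k n f = go (allFin k)
  where
  go : ∀ is → ∑ (concatMap (λ i → map (λ a → (i , a)) (allFin n)) is) f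
            ≡ ∑ is (λ i → ∑ (allFin n) (λ a → f (i , a)))
  go []       = refl
  go (i ∷ is)
    rewrite map-++ f (map (i ,_) (allFin n)) (concatMap (λ i → map (λ a → (i , a)) (allFin n)) is)
          | sum-++ (map f (map (i ,_) (allFin n))) (map f (concatMap (λ i → map (λ a → (i , a)) (allFin n)) is))
          | go is
          | map-∘ {g = f} {f = (i ,_)} (allFin n) = refl

∑-allFin-suc : ∀ n (f : Fin (suc n) → ℕ) → ∑ (allFin (suc n)) f ≡ f fz + ∑ (allFin n) (f ∘ fs)
∑-allFin-suc n f = cong (λ l → f fz + sum l) (trans (map-tabulate fs f) (sym (map-tabulate id (f ∘ fs))))

length-allFin : ∀ n → length (allFin n) ≡ n
length-allFin n = go n id
  where
  go : ∀ n {X : Set} (f : Fin n → X) → length (tabulate f) ≡ n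
  go zero    f = refl
  go (suc n) f = cong suc (go n (f ∘ fs))

∑-≡ᵇ : ∀ n c → ∑ (allFin n) (λ a → [ toℕ a ≡ᵇ c ]?) ≤ 1
∑-≡ᵇ zero    c = z≤n
∑-≡ᵇ (suc n) zero rewrite ∑-allFin-suc n (λ a → [ toℕ a ≡ᵇ 0 ]?)
                        | ∑-const (allFin n) 0 | *-zeroʳ (length (allFin n)) = s≤s z≤n
∑-≡ᵇ (suc n) (suc c) rewrite ∑-allFin-suc n (λ a → [ toℕ a ≡ᵇ suc c ]?) = ∑-≡ᵇ n c

∑-<ᵇ : ∀ n c → ∑ (allFin n) (λ a → [ toℕ a <ᵇ c ]?) ≤ c
∑-<ᵇ zero    c = z≤n
∑-<ᵇ (suc n) zero rewrite ∑-const (allFin (suc n)) 0 | *-zeroʳ (length (allFin (suc n))) = z≤n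
∑-<ᵇ (suc n) (suc c) rewrite ∑-allFin-suc n (λ a → [ toℕ a <ᵇ suc c ]?) = s≤s (∑-<ᵇ n c)

-- Walking around a cycle.

module Rotation {k n L : ℕ} {H : Graph k n} (C : ContainsCycle (suc L) H) where

  private
    f = proj₁ C
    ℓ = suc L

  at : ℕ → V k n
  at m = f (m mod ℓ)

  private
    toℕ-mod : ∀ m → toℕ (m mod ℓ) ≡ m % ℓ
    toℕ-mod m = toℕ-fromℕ< (m%n<n m ℓ)

    +-% : ∀ m d → (m + d) % ℓ ≡ (m % ℓ + d) % ℓ
    +-% m d = begin
      (m + d) % ℓ                            ≡⟨ cong (λ x → (x + d) % ℓ) (m≡m%n+[m/n]*n m ℓ) ⟩
      (m % ℓ + m / ℓ * ℓ + d) % ℓ            ≡⟨ cong (_% ℓ) (+-assoc (m % ℓ) (m / ℓ * ℓ) d) ⟩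
      (m % ℓ + (m / ℓ * ℓ + d)) % ℓ          ≡⟨ cong (λ x → (m % ℓ + x) % ℓ) (+-comm (m / ℓ * ℓ) d) ⟩
      (m % ℓ + (d + m / ℓ * ℓ)) % ℓ          ≡⟨ cong (_% ℓ) (+-assoc (m % ℓ) d _) ⟨
      (m % ℓ + d + m / ℓ * ℓ) % ℓ            ≡⟨ [m+kn]%n≡m%n (m % ℓ + d) (m / ℓ) ℓ ⟩
      (m % ℓ + d) % ℓ                        ∎
      where open ≡-Reasoning

    r+d≢r : ∀ r d → r < ℓ → 1 ≤ d → d < ℓ → (r + d) % ℓ ≢ r
    r+d≢r r d r<ℓ 1≤d d<ℓ eq with r + d <? ℓ
    ... | yes lt = <⇒≢ (m<m+n r 1≤d) (trans (sym eq) (m<n⇒m%n≡m lt))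
    ... | no ge  = <⇒≢ (+-cancelʳ-< ℓ _ _ (begin-strict
                     (r + d) ∸ ℓ + ℓ ≡⟨ m∸n+n≡m ℓ≤ ⟩
                     r + d           <⟨ +-monoʳ-< r d<ℓ ⟩
                     r + ℓ           ∎))
                   (begin-equality
                     (r + d) ∸ ℓ       ≡⟨ m<n⇒m%n≡m small ⟨
                     ((r + d) ∸ ℓ) % ℓ ≡⟨ m≤n⇒[n∸m]%m≡n%m ℓ≤ ⟩
                     (r + d) % ℓ       ≡⟨ eq ⟩
                     r                 ∎)
      where
      open ≤-Reasoning
      ℓ≤ : ℓ ≤ r + d
      ℓ≤ = ≮⇒≥ ge
      small : (r + d) ∸ ℓ < ℓ
      small = +-cancelʳ-< ℓ _ _ (begin-strict
        (r + d) ∸ ℓ + ℓ ≡⟨ m∸n+n≡m ℓ≤ ⟩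
        r + d           <⟨ +-mono-< r<ℓ d<ℓ ⟩
        ℓ + ℓ           ∎)

  at-period : ∀ m → at (m + ℓ) ≡ at m
  at-period m = cong f (toℕ-injective
    (trans (toℕ-mod (m + ℓ)) (trans ([m+n]%n≡m%n m ℓ) (sym (toℕ-mod m)))))

  at-≢ : ∀ m d → 1 ≤ d → d < ℓ → at m ≢ at (m + d)
  at-≢ m d 1≤d d<ℓ eq = r+d≢r (m % ℓ) d (m%n<n m ℓ) 1≤d d<ℓ
    (trans (sym (+-% m d)) (trans (sym (toℕ-mod (m + d)))
      (trans (cong toℕ (sym (proj₁ (proj₂ C) eq))) (toℕ-mod m))))

  at-adj : ∀ m → H (at m) (at (suc m)) ≡ true
  at-adj m = proj₂ (proj₂ C) (m mod ℓ) (suc m mod ℓ) succ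
    where
    step : suc m % ℓ ≡ suc (m % ℓ) % ℓ
    step = trans (cong (_% ℓ) (+-comm 1 m)) (trans (+-% m 1) (cong (_% ℓ) (+-comm (m % ℓ) 1)))
    succ : CycSucc (m mod ℓ) (suc m mod ℓ)
    succ with suc (m % ℓ) <? ℓ
    ... | yes lt = inj₁ (trans (cong suc (toℕ-mod m))
                     (trans (sym (m<n⇒m%n≡m lt)) (trans (sym step) (sym (toℕ-mod (suc m))))))
    ... | no ge  = inj₂ (trans (cong suc (toℕ-mod m)) full ,
                     trans (toℕ-mod (suc m)) (trans step (trans (cong (_% ℓ) full) (n%n≡0 ℓ))))
      where
      full : suc (m % ℓ) ≡ ℓ
      full = ≤-antisym (m%n<n m ℓ) (≮⇒≥ ge)

-- Paths confined to regions, and closing them to cycles.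

module Paths {A : Set} (_~_ : A → A → Set) (OK : A → Set) where

  data Walk : A → A → List A → Set where
    [-] : ∀ {x} → Walk x x (x ∷ [])
    _∷_ : ∀ {x y z xs} → x ~ y → Walk y z xs → Walk x z (x ∷ xs)

  -- The region `P` is part of the type so that concatenation only needs disjoint regions; `ok`
  -- guarantees that every label on the path belongs to a vertex.
  record Path (P : A → Set) (x y : A) (n : ℕ) : Set where
    constructor path
    field
      {verts} : List A
      walk    : Walk x y verts
      unique  : Unique verts
      inside  : All P verts
      ok      : All OK verts
      size    : length verts ≡ n

  walk-++ : ∀ {x y z w xs ys} → Walk x y xs → y ~ z → Walk z w ys → Walk x w (xs ++ ys)
  walk-++ [-]     e q = e ∷ q
  walk-++ (d ∷ p) e q = d ∷ walk-++ p e q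

  relax : ∀ {P Q : A → Set} {x y n} → (∀ {a} → P a → Q a) → Path P x y n → Path Q x y n
  relax P⊆Q (path w u i o s) = path w u (All.map P⊆Q i) o s

  point : ∀ {x} → OK x → Path (_≡ x) x x 1
  point ok = path [-] ([] ∷ []) (refl ∷ []) (ok ∷ []) refl

  join : ∀ {P Q R : A → Set} {x y z w m n} → Path P x y m → y ~ z → Path Q z w n →
         (∀ {a} → P a → Q a → ⊥) → (∀ {a} → P a → R a) → (∀ {a} → Q a → R a) → Path R x w (m + n)
  join (path {xs} p u i o refl) e (path {ys} q v j o′ refl) disjoint P⊆R Q⊆R =
    path (walk-++ p e q)
         (Unique.++⁺ u v (λ { (a∈xs , a∈ys) → disjoint (All.lookup i a∈xs) (All.lookup j a∈ys) }))
         (All.++⁺ (All.map P⊆R i) (All.map Q⊆R j)) (All.++⁺ o o′) (length-++ xs)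

  lookup-injective : ∀ {xs : List A} → Unique xs → ∀ i j → lookup xs i ≡ lookup xs j → i ≡ j
  lookup-injective (_ ∷ _)  fz     fz     _  = refl
  lookup-injective (a ∷ _)  fz     (fs j) eq = ⊥-elim (All.lookup a (∈-lookup j) eq)
  lookup-injective (a ∷ _)  (fs i) fz     eq = ⊥-elim (All.lookup a (∈-lookup i) (sym eq))
  lookup-injective (_ ∷ us) (fs i) (fs j) eq = cong fs (lookup-injective us i j eq)

  walk-first : ∀ {x y xs} → Walk x y xs → ∀ j → toℕ j ≡ 0 → lookup xs j ≡ x
  walk-first [-]     fz _ = refl
  walk-first (_ ∷ _) fz _ = refl

  walk-last : ∀ {x y xs} → Walk x y xs → ∀ i → suc (toℕ i) ≡ length xs → lookup xs i ≡ y
  walk-last [-]           fz     _  = refl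
  walk-last (_ ∷ (_ ∷ _)) fz     ()
  walk-last (_ ∷ [-])     fz     ()
  walk-last (_ ∷ p)       (fs i) eq = walk-last p i (suc-injective eq)

  walk-step : ∀ {x y xs} → Walk x y xs → ∀ i j → suc (toℕ i) ≡ toℕ j → lookup xs i ~ lookup xs j
  walk-step (e ∷ p) fz     (fs j) eq = subst (_ ~_) (sym (walk-first p j (sym (suc-injective eq)))) e
  walk-step (_ ∷ p) (fs i) (fs j) eq = walk-step p i j (suc-injective eq)
  walk-step [-]     fz     fz     ()

module Close {A : Set} {_~_ : A → A → Set} {k n : ℕ} (label : V k n → A)
             (label-injective : ∀ {u v} → label u ≡ label v → u ≡ v) where

  open Paths _~_ (λ a → Σ (V k n) λ v → label v ≡ a)

  close : ∀ {P ℓ u v} {G : Graph k n} → (∀ a b → label a ~ label b → G a b ≡ true) → G v u ≡ true →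
          Path P (label u) (label v) ℓ → ContainsCycle ℓ G
  close {u = u} {v} {G} edge back (path {xs} w un _ ok refl) = at , at-injective , at-edge
    where
    pre : ∀ i → Σ (V k n) λ v → label v ≡ lookup xs i
    pre i = All.lookup ok (∈-lookup i)
    at : Fin (length xs) → V k n
    at i = proj₁ (pre i)
    at-injective : ∀ {i j} → at i ≡ at j → i ≡ j
    at-injective {i} {j} eq = lookup-injective un i j
      (trans (sym (proj₂ (pre i))) (trans (cong label eq) (proj₂ (pre j))))
    at-edge : ∀ i j → CycSucc i j → G (at i) (at j) ≡ true
    at-edge i j (inj₁ s) = edge _ _ (subst₂ _~_ (sym (proj₂ (pre i))) (sym (proj₂ (pre j))) (walk-step w i j s))
    at-edge i j (inj₂ (l , z))
      rewrite label-injective (trans (proj₂ (pre i)) (walk-last w i l))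
            | label-injective (trans (proj₂ (pre j)) (walk-first w j z)) = back

-- Booleans and parity.

true≢false : true ≢ false
true≢false ()

≡true⇒T : ∀ {b} → b ≡ true → T b
≡true⇒T = Equivalence.from T-≡

T⇒≡true : ∀ {b} → T b → b ≡ true
T⇒≡true = Equivalence.to T-≡

≢true⇒≡false : ∀ {b} → b ≢ true → b ≡ false
≢true⇒≡false = ¬-not

xor-cancelʳ : ∀ a b → (a xor b) xor b ≡ a
xor-cancelʳ true  true  = refl
xor-cancelʳ true  false = refl
xor-cancelʳ false true  = refl
xor-cancelʳ false false = refl

xor-notʳ : ∀ a b → a xor not b ≡ not (a xor b)
xor-notʳ true  b = refl
xor-notʳ false b = refl

xor-notˡ : ∀ a b → not a xor b ≡ not (a xor b)
xor-notˡ true  b = sym (not-involutive b)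
xor-notˡ false b = refl

∨-elim : ∀ a {b} → a ∨ b ≡ true → a ≡ true ⊎ b ≡ true
∨-elim true  _  = inj₁ refl
∨-elim false eq = inj₂ eq

even : ℕ → Bool
even zero    = true
even (suc c) = not (even c)

dbl : ℕ → ℕ
dbl zero    = zero
dbl (suc c) = suc (suc (dbl c))

even-dbl : ∀ c → even (dbl c) ≡ true
even-dbl zero    = refl
even-dbl (suc c) rewrite even-dbl c = refl

dbl-mono-≤ : ∀ {c d} → c ≤ d → dbl c ≤ dbl d
dbl-mono-≤ z≤n     = z≤n
dbl-mono-≤ (s≤s p) = s≤s (s≤s (dbl-mono-≤ p))

⌊dbl/2⌋ : ∀ c → ⌊ dbl c /2⌋ ≡ c
⌊dbl/2⌋ zero    = refl
⌊dbl/2⌋ (suc c) = cong suc (⌊dbl/2⌋ c)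

even-suc-suc : ∀ c → even (suc (suc c)) ≡ even c
even-suc-suc c = not-involutive (even c)

-- rl c s is a vertex of column c on one of the two rails, yy c is the third
-- vertex of column c, and lf p a is the leaf at position a of part p.
data Label : Set where
  rl : ℕ → Bool → Label
  yy : ℕ → Label
  lf : ℕ → ℕ → Label

_≟L_ : (x y : Label) → Dec (x ≡ y)
rl c s ≟L rl d t = map′ (λ { (refl , refl) → refl }) (λ { refl → refl , refl }) (c ≟ d ×-dec s ≟ᵇ t)
rl _ _ ≟L yy _   = no λ ()
rl _ _ ≟L lf _ _ = no λ ()
yy _   ≟L rl _ _ = no λ ()
yy c   ≟L yy d   = map′ (cong yy) (λ { refl → refl }) (c ≟ d)
yy _   ≟L lf _ _ = no λ ()
lf _ _ ≟L rl _ _ = no λ ()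
lf _ _ ≟L yy _   = no λ ()
lf p a ≟L lf q b = map′ (λ { (refl , refl) → refl }) (λ { refl → refl , refl }) (p ≟ q ×-dec a ≟ b)

member : Label → List Label → Bool
member x []       = false
member x (y ∷ ys) = ⌊ x ≟L y ⌋ ∨ member x ys

member⇒∈ : ∀ {x} ys → member x ys ≡ true → x ∈ ys
member⇒∈ {x} (y ∷ ys) eq with x ≟L y
... | yes x≡y = here x≡y
... | no _    = there (member⇒∈ ys eq)

∈⇒member : ∀ {x ys} → x ∈ ys → member x ys ≡ true
∈⇒member {x} {y ∷ ys} (here x≡y) with x ≟L y
... | yes _  = refl
... | no x≢y = ⊥-elim (x≢y x≡y)
∈⇒member {x} {y ∷ ys} (there p) rewrite ∈⇒member p = ∨-zeroʳ ⌊ x ≟L y ⌋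

-- A leaf gets the column of its host; truncation sends the parts 0, 1, 2 to column 0. Edges at
-- leaves thus never change the column.
col : Label → ℕ
col (rl c _) = c
col (yy c)   = c
col (lf p _) = dbl (p ∸ 2)

-- Together with the part, this recovers a vertex from its label.
pos : Label → ℕ
pos (rl c _) = c
pos (yy c)   = c
pos (lf _ a) = a

-- The hosts for the parts 0, 1, 2 are the vertices of column 0, which lie in the parts 1, 2, 0.
host : ℕ → Label
host 0                   = rl 0 true
host 1                   = yy 0
host 2                   = rl 0 false
host (suc (suc (suc p))) = rl (dbl (suc p)) true

-- The graph: labels, owned edges, and compatibility with the parts.

module Construction (h m n : ℕ) (ε : Bool) (large : 2 + dbl h ≤ m) (room : suc m < n) where

  M : ℕ
  M = suc m

  -- The special columns 2, 4, …, 2h have parts 2 and 3, 4, …, 2 + h and no third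
  -- vertex; leaves of the latter part hang at the vertex of part 2.
  sp : ℕ → Bool
  sp c = even c ∧ (0 <ᵇ c) ∧ (c ≤ᵇ dbl h)

  sp-elim : ∀ c → sp c ≡ true → even c ≡ true × 1 ≤ c × c ≤ dbl h
  sp-elim c eq with even c | 0 <ᵇ c in eq₁ | c ≤ᵇ dbl h in eq₂
  sp-elim c eq | true | true | true = refl , <ᵇ⇒< 0 c (≡true⇒T eq₁) , ≤ᵇ⇒≤ c (dbl h) (≡true⇒T eq₂)

  sp-intro : ∀ {c} → even c ≡ true → 1 ≤ c → c ≤ dbl h → sp c ≡ true
  sp-intro {c} ev 1≤c c≤ rewrite ev | T⇒≡true (<⇒<ᵇ 1≤c) = T⇒≡true (≤⇒≤ᵇ c≤)

  sp-> : ∀ {c} → dbl h < c → sp c ≡ false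
  sp-> {c} lt = ≢true⇒≡false λ eq → <⇒≱ lt (proj₂ (proj₂ (sp-elim c eq)))

  sp-odd : ∀ {c} → even c ≡ false → sp c ≡ false
  sp-odd eq rewrite eq = refl

  sp-suc : ∀ {c} → sp c ≡ true → sp (suc c) ≡ false
  sp-suc {c} eq = sp-odd {suc c} (cong not (proj₁ (sp-elim c eq)))

  sp-pred : ∀ {c} → sp (suc c) ≡ true → sp c ≡ false
  sp-pred {c} eq = sp-odd {c} (trans (sym (not-involutive (even c))) (cong not (proj₁ (sp-elim (suc c) eq))))

  -- One of `i` and `suc i` is even and positive, so it can fail to be special only by exceeding
  -- `dbl h`.
  sp-pair : ∀ {i} → 1 ≤ i → sp i ≡ false → sp (suc i) ≡ false → ∀ {c} → i ≤ c → sp c ≡ false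
  sp-pair {i} 1≤i no₁ no₂ {c} i≤c with m≤n⇒m<n∨m≡n i≤c
  ... | inj₂ refl = no₁
  ... | inj₁ i<c  = sp-> (<-≤-trans far i<c)
    where
    far : dbl h < suc i
    far with even i in eq
    ... | true  = ≰⇒> λ le → true≢false (trans (sym (sp-intro eq 1≤i (≤-trans (n≤1+n i) le))) (nosp eq))
      where
      nosp : even i ≡ true → sp i ≡ false
      nosp _ = subst (λ b → b ∧ (0 <ᵇ i) ∧ (i ≤ᵇ dbl h) ≡ false) (sym eq) no₁
    ... | false = ≰⇒> λ le → true≢false (trans (sym (sp-intro (cong not eq) (s≤s z≤n) le))
                      (subst (λ b → not b ∧ true ∧ (suc i ≤ᵇ dbl h) ≡ false) (sym eq) no₂))

  sp-dbl : ∀ {d} → d < h → sp (dbl (suc d)) ≡ true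
  sp-dbl {d} d<h = sp-intro {dbl (suc d)} (even-dbl (suc d)) (s≤s z≤n) (dbl-mono-≤ d<h)

  m-plain : sp m ≡ false
  m-plain = sp-> (≤-trans (n≤1+n _) large)

  M-plain : sp M ≡ false
  M-plain = sp-> (≤-trans (≤-trans (n≤1+n _) large) (n≤1+n m))

  part : Label → ℕ
  part (rl c s) = if sp c then (if s then 2 else 2 + ⌊ c /2⌋) else (if s xor even c then 0 else 1)
  part (yy _)   = 2
  part (lf p _) = p

  -- The vertices of column c of the ladder sit at position c of their part;
  -- all other vertices of K_k^n are leaves.
  label-special label-plain label : ℕ → ℕ → Label
  label-special p a =
    if p ≡ᵇ 2 then rl a true else (if p ≡ᵇ 2 + ⌊ a /2⌋ then rl a false else lf p a)
  label-plain 0 a = rl a (not (even a))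
  label-plain 1 a = rl a (even a)
  label-plain 2 a = if (a <ᵇ M) ∨ ε then yy a else lf 2 a
  label-plain (suc (suc (suc p))) a = lf (3 + p) a
  label p a = if a ≤ᵇ M then (if sp a then label-special p a else label-plain p a) else lf p a

  data Good : Label → Set where
    good-rl : ∀ {c s} → c ≤ M → Good (rl c s)
    good-yy : ∀ {c} → c ≤ M → sp c ≡ false → c < M ⊎ ε ≡ true → Good (yy c)
    good-lf : ∀ {p a} → p < 3 + h → Good (lf p a)

  private
    not-xor : ∀ b → not b xor b ≡ true
    not-xor true  = refl
    not-xor false = refl
    xor-same : ∀ b → b xor b ≡ false
    xor-same true  = refl
    xor-same false = refl

  record Labelled (p a : ℕ) (x : Label) : Set where
    constructor labelled
    field
      part≡ : part x ≡ p
      pos≡  : pos x ≡ a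
      good  : Good x

  label-spec : ∀ p a → p < 3 + h → Labelled p a (label p a)
  label-spec p a p< with a ≤ᵇ M in a≤
  ... | false = labelled refl refl (good-lf p<)
  ... | true with sp a in spa
  ... | false = plain p p<
    where
    a≤M = ≤ᵇ⇒≤ a M (≡true⇒T a≤)
    plain : ∀ p → p < 3 + h → Labelled p a (label-plain p a)
    plain 0 _ = labelled eq refl (good-rl a≤M)
      where
      eq : part (rl a (not (even a))) ≡ 0
      eq rewrite spa | not-xor (even a) = refl
    plain 1 _ = labelled eq refl (good-rl a≤M)
      where
      eq : part (rl a (even a)) ≡ 1
      eq rewrite spa | xor-same (even a) = refl
    plain 2 q with (a <ᵇ M) ∨ ε in ex
    ... | false = labelled refl refl (good-lf q)
    ... | true with ∨-elim (a <ᵇ M) ex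
    ... | inj₁ lt = labelled refl refl (good-yy a≤M spa (inj₁ (<ᵇ⇒< a M (≡true⇒T lt))))
    ... | inj₂ e  = labelled refl refl (good-yy a≤M spa (inj₂ e))
    plain (suc (suc (suc p))) q = labelled refl refl (good-lf q)
  ... | true with p ≡ᵇ 2 in p2
  ... | true = labelled eq refl (good-rl (≤ᵇ⇒≤ a M (≡true⇒T a≤)))
    where
    eq : part (rl a true) ≡ p
    eq rewrite spa = sym (≡ᵇ⇒≡ p 2 (≡true⇒T p2))
  ... | false with p ≡ᵇ 2 + ⌊ a /2⌋ in pb
  ... | true = labelled eq refl (good-rl (≤ᵇ⇒≤ a M (≡true⇒T a≤)))
    where
    eq : part (rl a false) ≡ p
    eq rewrite spa = sym (≡ᵇ⇒≡ p (2 + ⌊ a /2⌋) (≡true⇒T pb))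
  ... | false = labelled refl refl (good-lf p<)

  labelV : V (3 + h) n → Label
  labelV (i , a) = label (toℕ i) (toℕ a)

  labelV-spec : ∀ u → Labelled (toℕ (proj₁ u)) (toℕ (proj₂ u)) (labelV u)
  labelV-spec (i , a) = label-spec (toℕ i) (toℕ a) (toℕ<n i)

  labelV-injective : ∀ {u v} → labelV u ≡ labelV v → u ≡ v
  labelV-injective {u} {v} eq = cong₂ _,_
    (toℕ-injective (trans (sym (part≡ (labelV-spec u))) (trans (cong part eq) (part≡ (labelV-spec v)))))
    (toℕ-injective (trans (sym (pos≡ (labelV-spec u))) (trans (cong pos eq) (pos≡ (labelV-spec v)))))
    where open Labelled

  OK : Label → Set
  OK x = Σ (V (3 + h) n) λ v → labelV v ≡ x

  ok-label : ∀ {p a x} → p < 3 + h → a ≤ M → label p a ≡ x → OK x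
  ok-label {p} {a} p< a≤M eq = (fromℕ< p< , fromℕ< (≤-<-trans a≤M room)) ,
    trans (cong₂ label (toℕ-fromℕ< p<) (toℕ-fromℕ< (≤-<-trans a≤M room))) eq

  private
    ≤M : ∀ {c} → c ≤ M → (c ≤ᵇ M) ≡ true
    ≤M = T⇒≡true ∘ ≤⇒≤ᵇ

    ≡ᵇ-refl : ∀ c → (c ≡ᵇ c) ≡ true
    ≡ᵇ-refl c = T⇒≡true (≡⇒≡ᵇ c c refl)

  half-positive : ∀ {c} → sp c ≡ true → 1 ≤ ⌊ c /2⌋
  half-positive {zero}        ()
  half-positive {suc zero}    ()
  half-positive {suc (suc c)} _ = s≤s z≤n

  ok-rl : ∀ {c s} → c ≤ M → OK (rl c s)
  ok-rl {c} {s} c≤M with sp c in spc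
  ok-rl {c} {true} c≤M | true = ok-label (s≤s (s≤s (s≤s z≤n))) c≤M eq
    where
    eq : label 2 c ≡ rl c true
    eq rewrite ≤M c≤M | spc = refl
  ok-rl {c} {false} c≤M | true = ok-label (+-monoʳ-≤ 3 half≤h) c≤M eq
    where
    half≤h : ⌊ c /2⌋ ≤ h
    half≤h = subst (⌊ c /2⌋ ≤_) (⌊dbl/2⌋ h) (⌊n/2⌋-mono (proj₂ (proj₂ (sp-elim c spc))))
    eq : label (2 + ⌊ c /2⌋) c ≡ rl c false
    -- Half of `c` is positive, so the test for part 2 fails and the second test of `label-special`
    -- decides.
    eq rewrite ≤M c≤M | spc with ⌊ c /2⌋ | half-positive {c} spc
    ... | suc d | _ rewrite ≡ᵇ-refl d = refl
  ok-rl {c} {s} c≤M | false with s xor even c in e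
  ... | true = ok-label {0} (s≤s z≤n) c≤M eq
    where
    s≡ : ∀ s b → s xor b ≡ true → not b ≡ s
    s≡ true  false _ = refl
    s≡ false true  _ = refl
    eq : label 0 c ≡ rl c s
    eq rewrite ≤M c≤M | spc = cong (rl c) (s≡ s (even c) e)
  ... | false = ok-label {1} (s≤s (s≤s z≤n)) c≤M eq
    where
    s≡ : ∀ s b → s xor b ≡ false → b ≡ s
    s≡ true  true  _ = refl
    s≡ false false _ = refl
    eq : label 1 c ≡ rl c s
    eq rewrite ≤M c≤M | spc = cong (rl c) (s≡ s (even c) e)

  ok-yy : ∀ {c} → c ≤ M → sp c ≡ false → c < M ⊎ ε ≡ true → OK (yy c)
  ok-yy {c} c≤M spc ex = ok-label {2} (s≤s (s≤s (s≤s z≤n))) c≤M eq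
    where
    exists : c < M ⊎ ε ≡ true → ((c <ᵇ M) ∨ ε) ≡ true
    exists (inj₁ lt) rewrite T⇒≡true (<⇒<ᵇ lt) = refl
    exists (inj₂ e)  = trans (cong ((c <ᵇ M) ∨_) e) (∨-zeroʳ (c <ᵇ M))
    eq : label 2 c ≡ yy c
    eq rewrite ≤M c≤M | spc | exists ex = refl

  when : Bool → Label → List Label
  when b x = if b then x ∷ [] else []

  rungs down : ℕ → Bool → List Label
  rungs c s = if s then [] else rl c true ∷ []
  down zero    s = []
  down (suc c) s = rl c s ∷ when (sp c ∨ sp (suc c)) (rl c (not s)) ++ when (sp c) (rl (pred c) (not s))

  ends : ℕ → List Label
  ends zero    = rl 1 true ∷ rl 1 false ∷ []
  ends (suc c) = if c ≡ᵇ m then rl c true ∷ rl c false ∷ [] else []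

  outs : Label → List Label
  outs (rl c s) = rungs c s ++ down c s
  outs (yy c)   = rl c true ∷ rl c false ∷ ends c
  outs (lf p _) = host p ∷ []

  -- Every edge is owned by one endpoint, so that the edges can be counted by
  -- owners.  jump joins the two neighbours of a special column: as that column has
  -- no third vertex, no long path between them exists.
  data Own : Label → Label → Set where
    rung  : ∀ c → Own (rl c false) (rl c true)
    rail  : ∀ c s → Own (rl (suc c) s) (rl c s)
    cross : ∀ c s → sp c ∨ sp (suc c) ≡ true → Own (rl (suc c) s) (rl c (not s))
    jump  : ∀ c s → sp c ≡ true → Own (rl (suc c) s) (rl (pred c) (not s))
    tri   : ∀ c s → Own (yy c) (rl c s)
    capL  : ∀ s → Own (yy 0) (rl 1 s)
    capR  : ∀ s → Own (yy M) (rl m s)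
    hang  : ∀ p a → Own (lf p a) (host p)

  ∈-when⁻ : ∀ {b x y} → y ∈ when b x → b ≡ true × y ≡ x
  ∈-when⁻ {true} (here eq) = refl , eq

  ∈-when⁺ : ∀ {b} x → b ≡ true → x ∈ when b x
  ∈-when⁺ x refl = here refl

  ∈-down⁻ : ∀ c s {y} → y ∈ down c s → Own (rl c s) y
  ∈-down⁻ (suc c) s (here refl) = rail c s
  ∈-down⁻ (suc c) s (there p) with ∈-++⁻ (when (sp c ∨ sp (suc c)) (rl c (not s))) p
  ... | inj₁ q with ∈-when⁻ q
  ... | b , refl = cross c s b
  ∈-down⁻ (suc c) s (there p) | inj₂ q with ∈-when⁻ q
  ... | b , refl = jump c s b

  ∈⇒Own : ∀ x {y} → y ∈ outs x → Own x y
  ∈⇒Own (rl c true)  p           = ∈-down⁻ c true p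
  ∈⇒Own (rl c false) (here refl) = rung c
  ∈⇒Own (rl c false) (there p)   = ∈-down⁻ c false p
  ∈⇒Own (yy c) (here refl)         = tri c true
  ∈⇒Own (yy c) (there (here refl)) = tri c false
  ∈⇒Own (yy zero) (there (there (here refl)))         = capL true
  ∈⇒Own (yy zero) (there (there (there (here refl)))) = capL false
  ∈⇒Own (yy (suc c)) (there (there p)) with c ≡ᵇ m in eq
  ... | true with ≡ᵇ⇒≡ c m (≡true⇒T eq) | p
  ... | refl | here refl         = capR true
  ... | refl | there (here refl) = capR false
  ∈⇒Own (lf p a) (here refl) = hang p a

  Own⇒∈ : ∀ {x y} → Own x y → y ∈ outs x
  Own⇒∈ (rung c)       = here refl
  Own⇒∈ (rail c s)     = ∈-++⁺ʳ (rungs (suc c) s) (here refl)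
  Own⇒∈ (cross c s e)  = ∈-++⁺ʳ (rungs (suc c) s) (there (∈-++⁺ˡ (∈-when⁺ _ e)))
  Own⇒∈ (jump c s e)   = ∈-++⁺ʳ (rungs (suc c) s)
                           (there (∈-++⁺ʳ (when (sp c ∨ sp (suc c)) (rl c (not s))) (∈-when⁺ _ e)))
  Own⇒∈ (tri c true)   = here refl
  Own⇒∈ (tri c false)  = there (here refl)
  Own⇒∈ (capL true)    = there (there (here refl))
  Own⇒∈ (capL false)   = there (there (there (here refl)))
  Own⇒∈ (capR true)  rewrite ≡ᵇ-refl m = there (there (here refl))
  Own⇒∈ (capR false) rewrite ≡ᵇ-refl m = there (there (there (here refl)))
  Own⇒∈ (hang p a)     = here refl

  _~_ : Label → Label → Set
  x ~ y = Own x y ⊎ Own y x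

  ~-sym : ∀ {x y} → x ~ y → y ~ x
  ~-sym = swap

  adj : Label → Label → Bool
  adj x y = member y (outs x) ∨ member x (outs y)

  adj⇒~ : ∀ x y → adj x y ≡ true → x ~ y
  adj⇒~ x y eq with member y (outs x) in e₁
  ... | true  = inj₁ (∈⇒Own x (member⇒∈ (outs x) e₁))
  ... | false = inj₂ (∈⇒Own y (member⇒∈ (outs y) eq))

  ~⇒adj : ∀ {x y} → x ~ y → adj x y ≡ true
  ~⇒adj (inj₁ o) rewrite ∈⇒member (Own⇒∈ o) = refl
  ~⇒adj {x} {y} (inj₂ o) rewrite ∈⇒member (Own⇒∈ o) = ∨-zeroʳ (member y (outs x))

  H : Graph (3 + h) n
  H u v = adj (labelV u) (labelV v)

  part-plain : ∀ {c s} → sp c ≡ false → part (rl c s) ≤ 1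
  part-plain {c} {s} eq rewrite eq with s xor even c
  ... | true  = z≤n
  ... | false = s≤s z≤n

  part-special : ∀ {c s} → sp c ≡ true → 2 ≤ part (rl c s)
  part-special {c} {true}  eq rewrite eq = s≤s (s≤s z≤n)
  part-special {c} {false} eq rewrite eq = s≤s (s≤s z≤n)

  part-mixed : ∀ {c d s t} → sp c ≡ true → sp d ≡ false → part (rl c s) ≢ part (rl d t)
  part-mixed {c} {d} {s} {t} spc spd eq =
    <⇒≱ (s≤s (part-plain {d} {t} spd)) (subst (2 ≤_) eq (part-special {c} {s} spc))

  sp-dec : ∀ c → sp c ≡ true ⊎ sp c ≡ false
  sp-dec c with sp c
  ... | true  = inj₁ refl
  ... | false = inj₂ refl

  part-plain-≡ : ∀ c s → sp c ≡ false → part (rl c s) ≡ (if s xor even c then 0 else 1)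
  part-plain-≡ c s eq rewrite eq = refl

  private
    parity-clash : ∀ s t b d → s xor b ≡ not (t xor d) →
                   (if s xor b then 0 else 1) ≢ (if t xor d then 0 else 1)
    parity-clash s t b d eq with s xor b | t xor d
    parity-clash s t b d ()   | true  | true
    parity-clash s t b d eq   | true  | false = λ ()
    parity-clash s t b d eq   | false | true  = λ ()
    parity-clash s t b d ()   | false | false

  part-clash : ∀ {c d s t} → sp c ≡ false → sp d ≡ false → s xor even c ≡ not (t xor even d) →
               part (rl c s) ≢ part (rl d t)
  part-clash {c} {d} {s} {t} spc spd e eq = parity-clash s t (even c) (even d) e
    (trans (sym (part-plain-≡ c s spc)) (trans eq (part-plain-≡ d t spd)))

  -- Rails alternate between the parts 0 and 1 on plain columns, while both vertices of a special
  -- column lie in parts from 2 on. `Good x` supplies, for a third vertex, that its column is plain.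
  own-part : ∀ {x y} → Good x → Own x y → part x ≢ part y
  own-part _ (rung c) eq with sp-dec c
  ... | inj₂ spc = part-clash {c} {c} {false} {true} spc spc (sym (not-involutive (even c))) eq
  ... | inj₁ spc = <⇒≢ (half-positive {c} spc) (+-cancelˡ-≡ 2 _ _ (trans (sym (low spc)) (trans (sym eq) (high spc))))
    where
    low : sp c ≡ true → part (rl c true) ≡ 2
    low e rewrite e = refl
    high : sp c ≡ true → part (rl c false) ≡ 2 + ⌊ c /2⌋
    high e rewrite e = refl
  own-part _ (rail c s) with sp-dec c | sp-dec (suc c)
  ... | inj₁ p | _      = part-mixed {c} {suc c} {s} {s} p (sp-suc {c} p) ∘ sym
  ... | inj₂ q | inj₁ p = part-mixed {suc c} {c} {s} {s} p q
  ... | inj₂ q | inj₂ r = part-clash {suc c} {c} {s} {s} r q (xor-notʳ s (even c))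
  own-part _ (cross c s e) with sp-dec c | sp-dec (suc c)
  ... | inj₁ p | _      = part-mixed {c} {suc c} {not s} {s} p (sp-suc {c} p) ∘ sym
  ... | inj₂ q | inj₁ p = part-mixed {suc c} {c} {s} {not s} p q
  ... | inj₂ q | inj₂ r = λ _ → true≢false (trans (sym e) (cong₂ _∨_ q r))
  own-part _ (jump zero s ())
  own-part _ (jump (suc c) s e) = part-clash {suc (suc c)} {c} {s} {not s} (sp-suc {suc c} e) (sp-pred {c} e) flip
    where
    not-xor-not : ∀ s b → s xor b ≡ not (not s xor b)
    not-xor-not true  b = refl
    not-xor-not false b = sym (not-involutive b)
    flip : s xor even (suc (suc c)) ≡ not (not s xor even c)
    flip = trans (cong (s xor_) (even-suc-suc c)) (not-xor-not s (even c))
  own-part (good-yy _ spc _) (tri c s) eq = <⇒≱ (s≤s (part-plain {c} {s} spc)) (≤-reflexive eq)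
  own-part _ (capL s) eq = <⇒≱ (s≤s (part-plain {1} {s} refl)) (≤-reflexive eq)
  own-part _ (capR s) eq = <⇒≱ (s≤s (part-plain {m} {s} m-plain)) (≤-reflexive eq)
  own-part _ (hang 0 a) ()
  own-part _ (hang 1 a) ()
  own-part _ (hang 2 a) ()
  own-part _ (hang (suc (suc (suc p))) a) eq with sp-dec (dbl (suc p))
  ... | inj₂ q = <⇒≱ (s≤s (part-plain {dbl (suc p)} {true} q)) (≤-trans (s≤s (s≤s z≤n)) (≤-reflexive eq))
  ... | inj₁ q with trans eq (low q)
    where
    low : sp (dbl (suc p)) ≡ true → part (rl (dbl (suc p)) true) ≡ 2
    low e rewrite e = refl
  ... | ()

  H-spanning : SpanningSub H
  H-spanning = (λ u v → ∨-comm (member (labelV v) (outs (labelV u))) _) , λ u v e eq →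
    different u v (adj⇒~ _ _ e) (cong toℕ eq)
    where
    open Labelled
    parts : ∀ u v → toℕ (proj₁ u) ≡ toℕ (proj₁ v) → part (labelV u) ≡ part (labelV v)
    parts u v eq = trans (part≡ (labelV-spec u)) (trans eq (sym (part≡ (labelV-spec v))))
    different : ∀ u v → labelV u ~ labelV v → toℕ (proj₁ u) ≢ toℕ (proj₁ v)
    different u v (inj₁ o) eq = own-part (good (labelV-spec u)) o (parts u v eq)
    different u v (inj₂ o) eq = own-part (good (labelV-spec v)) o (sym (parts u v eq))

-- Absence of cycles with `suc L` vertices.

enc : ℕ → Bool → ℕ
enc c true  = dbl c
enc c false = suc (dbl c)

dbl≢suc-dbl : ∀ c d → dbl c ≢ suc (dbl d)
dbl≢suc-dbl zero    d       ()
dbl≢suc-dbl (suc c) zero    ()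
dbl≢suc-dbl (suc c) (suc d) eq = dbl≢suc-dbl c d (suc-injective (suc-injective eq))

dbl-injective : ∀ {c d} → dbl c ≡ dbl d → c ≡ d
dbl-injective {zero}  {zero}  _  = refl
dbl-injective {suc c} {suc d} eq = cong suc (dbl-injective (suc-injective (suc-injective eq)))

enc-injective : ∀ {c d} s t → enc c s ≡ enc d t → rl c s ≡ rl d t
enc-injective true  true  eq rewrite dbl-injective eq = refl
enc-injective {c} {d} true  false eq = ⊥-elim (dbl≢suc-dbl c d eq)
enc-injective {c} {d} false true  eq = ⊥-elim (dbl≢suc-dbl d c (sym eq))
enc-injective false false eq rewrite dbl-injective (suc-injective eq) = refl

enc-< : ∀ {c d} s → c ≤ d → enc c s < 2 + dbl d
enc-< true  c≤d = s≤s (m≤n⇒m≤1+n (dbl-mono-≤ c≤d))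
enc-< false c≤d = s≤s (s≤s (dbl-mono-≤ c≤d))

module NoCycle (h m n : ℕ) (ε : Bool) (large : 2 + dbl h ≤ m) (room : suc m < n) where

  open Construction h m n ε large room

  -- The count of `2 + dbl M` rail vertices, `yy 0`, and `yy M` if it exists.
  L : ℕ
  L = [ ε ]? + (3 + dbl M)

  data Rail : Label → Set where
    rail  : ∀ {c} s → c ≤ M → Rail (rl c s)
    left  : Rail (yy 0)
    right : ε ≡ true → Rail (yy M)

  -- A numbering of the `Rail` labels below `L`. The last number is meant for `yy M`, and the value
  -- at leaves is a mere default.
  code : Label → ℕ
  code (rl c s)     = enc c s
  code (yy zero)    = 2 + dbl M
  code (yy (suc _)) = 3 + dbl M
  code (lf _ _)     = 0

  code-< : ∀ {x} → Rail x → code x < L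
  code-< (rail s c≤M)  = <-≤-trans (enc-< s c≤M) (≤-trans (n≤1+n _) (m≤n+m _ [ ε ]?))
  code-< left          = m≤n+m _ [ ε ]?
  code-< (right e) rewrite e = ≤-refl

  code-injective : ∀ {x y} → Rail x → Rail y → code x ≡ code y → x ≡ y
  code-injective (rail s _)   (rail t _)   eq = enc-injective s t eq
  code-injective (rail s c≤M) left         eq = ⊥-elim (<⇒≢ (enc-< s c≤M) eq)
  code-injective (rail s c≤M) (right _)    eq = ⊥-elim (<⇒≢ (m<n⇒m<1+n (enc-< s c≤M)) eq)
  code-injective left         (rail s c≤M) eq = ⊥-elim (<⇒≢ (enc-< s c≤M) (sym eq))
  code-injective (right _)    (rail s c≤M) eq = ⊥-elim (<⇒≢ (m<n⇒m<1+n (enc-< s c≤M)) (sym eq))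
  code-injective left         left         _  = refl
  code-injective left         (right _)    eq = ⊥-elim (<⇒≢ ≤-refl eq)
  code-injective (right _)    left         eq = ⊥-elim (<⇒≢ ≤-refl (sym eq))
  code-injective (right _)    (right _)    _  = refl

  record Inner (x : Label) : Set where
    constructor inner
    field
      {c}   : ℕ
      form  : x ≡ yy c
      low   : 1 ≤ c
      high  : c < M
      plain : sp c ≡ false

  host≢lf : ∀ q {p a} → host q ≢ lf p a
  host≢lf 0 ()
  host≢lf 1 ()
  host≢lf 2 ()
  host≢lf (suc (suc (suc q))) ()

  host-yy : ∀ q {c} → host q ≡ yy c → c ≡ 0
  host-yy 0 ()
  host-yy 1 refl = refl
  host-yy 2 ()
  host-yy (suc (suc (suc q))) ()

  col-host : ∀ p a → col (lf p a) ≡ col (host p)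
  col-host 0 a = refl
  col-host 1 a = refl
  col-host 2 a = refl
  col-host (suc (suc (suc p))) a = refl

  own-to-lf : ∀ {x y p a} → Own x y → y ≢ lf p a
  own-to-lf (hang q _) eq = host≢lf q eq
  own-to-lf (rung c) ()
  own-to-lf (rail c s) ()
  own-to-lf (cross c s x) ()
  own-to-lf (jump c s x) ()
  own-to-lf (tri c s) ()
  own-to-lf (capL s) ()
  own-to-lf (capR s) ()

  own-to-yy : ∀ {x y c} → Own x y → y ≡ yy c → c ≡ 0
  own-to-yy (hang q _) eq = host-yy q eq
  own-to-yy (rung c) ()
  own-to-yy (rail c s) ()
  own-to-yy (cross c s x) ()
  own-to-yy (jump c s x) ()
  own-to-yy (tri c s) ()
  own-to-yy (capL s) ()
  own-to-yy (capR s) ()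

  neighbour-lf : ∀ {p a y} → lf p a ~ y → y ≡ host p
  neighbour-lf (inj₁ (hang _ _)) = refl
  neighbour-lf (inj₂ o)          = ⊥-elim (own-to-lf o refl)

  neighbour-yy : ∀ {c y} → 1 ≤ c → c < M → yy c ~ y → Σ Bool λ s → y ≡ rl c s
  neighbour-yy _   _   (inj₁ (tri c s)) = s , refl
  neighbour-yy _   lt  (inj₁ (capR s))  = ⊥-elim (<-irrefl refl lt)
  neighbour-yy 1≤c _   (inj₂ o)         = ⊥-elim (<⇒≢ 1≤c (sym (own-to-yy o refl)))

  private
    gap : ∀ {b c} → b < c → c < suc b → ⊥
    gap b<c (s≤s c≤b) = <⇒≱ b<c c≤b

  -- Only `jump` edges skip a column, and the skipped column is special.
  own-no-jump : ∀ {x y c} → Own x y → sp c ≡ false →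
                (col x < c → c < col y → ⊥) × (col y < c → c < col x → ⊥)
  own-no-jump (rung c)      _ = <-asym , <-asym
  own-no-jump (rail c s)    _ = (λ p q → <-asym p (m<n⇒m<1+n q)) , gap
  own-no-jump (cross c s _) _ = (λ p q → <-asym p (m<n⇒m<1+n q)) , gap
  own-no-jump (jump zero s ()) _
  own-no-jump {c = c} (jump (suc b) s spb) spc =
    (λ p q → <-asym p (m<n⇒m<1+n (m<n⇒m<1+n q))) ,
    λ { p (s≤s q) → true≢false (trans (sym spb) (subst (λ x → sp x ≡ false) (≤-antisym q p) spc)) }
  own-no-jump (tri c s)     _ = <-asym , <-asym
  own-no-jump (capL s)      _ = (λ p q → gap p q) , (λ p q → <⇒≱ q z≤n)
  own-no-jump (capR s)      _ = (λ p q → <-asym p (m<n⇒m<1+n q)) , gap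
  own-no-jump {c = c} (hang p a) _ =
    (λ q r → <-asym q (subst (c <_) (sym (col-host p a)) r)) ,
    (λ q r → <-asym q (subst (c <_) (col-host p a) r))

  no-jump : ∀ {x y c} → x ~ y → sp c ≡ false → col y ≢ c →
            (col x < c → col y < c) × (c < col x → c < col y)
  no-jump {x} {y} {c} (inj₁ o) spc ne =
    (λ lt → ≤∧≢⇒< (≮⇒≥ (proj₁ (own-no-jump o spc) lt)) ne) ,
    (λ lt → ≤∧≢⇒< (≮⇒≥ (λ lt′ → proj₂ (own-no-jump o spc) lt′ lt)) (ne ∘ sym))
  no-jump {x} {y} {c} (inj₂ o) spc ne =
    (λ lt → ≤∧≢⇒< (≮⇒≥ (proj₂ (own-no-jump o spc) lt)) ne) ,
    (λ lt → ≤∧≢⇒< (≮⇒≥ (λ lt′ → proj₁ (own-no-jump o spc) lt′ lt)) (ne ∘ sym))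

  module _ (C : ContainsCycle (suc L) H) where

    open Rotation {H = H} C

    g : ℕ → Label
    g i = labelV (at i)

    g-good : ∀ i → Good (g i)
    g-good i = Labelled.good (labelV-spec (at i))

    g-adj : ∀ i → g i ~ g (suc i)
    g-adj i = adj⇒~ _ _ (at-adj i)

    g-back : ∀ i → g i ~ g (i + L)
    g-back i = ~-sym (subst (λ v → g (i + L) ~ labelV v)
      (trans (cong at (sym (+-suc i L))) (at-period i)) (g-adj (i + L)))

    g-≢ : ∀ i d → 1 ≤ d → d ≤ L → g i ≢ g (i + d)
    g-≢ i d 1≤d d≤L eq = at-≢ i d 1≤d (s≤s d≤L) (labelV-injective eq)

    3≤L : 3 ≤ L
    3≤L = ≤-trans (s≤s (s≤s (s≤s z≤n))) (m≤n+m (3 + dbl M) [ ε ]?)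

    L-1 : Σ ℕ λ K → L ≡ suc K × 1 ≤ K
    L-1 with L | 3≤L
    ... | suc K | s≤s 2≤K = K , refl , ≤-trans (n≤1+n 1) 2≤K

    g-ends-≢ : ∀ i → g (suc i) ≢ g (i + L)
    g-ends-≢ i eq with L-1
    ... | K , L≡ , 1≤K = g-≢ (suc i) K 1≤K (≤-trans (n≤1+n K) (≤-reflexive (sym L≡)))
            (trans eq (cong g (trans (cong (i +_) L≡) (+-suc i K))))

    -- A leaf has a single neighbour, whereas predecessor and successor on the cycle differ.
    no-leaf : ∀ i {p a} → g i ≢ lf p a
    no-leaf i eq = g-ends-≢ i (trans (neighbour-lf (subst (_~ g (suc i)) eq (g-adj i)))
                                (sym (neighbour-lf (subst (_~ g (i + L)) eq (g-back i)))))

    classify : ∀ i → Rail (g i) ⊎ Inner (g i)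
    classify i = go (g-good i) refl
      where
      go : ∀ {x} → Good x → g i ≡ x → Rail x ⊎ Inner x
      go (good-lf _) eq = ⊥-elim (no-leaf i eq)
      go (good-rl {s = s} c≤M) _ = inj₁ (rail s c≤M)
      go (good-yy {zero} _ _ _) _ = inj₁ left
      go (good-yy {suc c} _ spc (inj₁ lt)) _ = inj₂ (inner refl (s≤s z≤n) lt spc)
      go (good-yy {suc c} c≤M spc (inj₂ e)) _ with m≤n⇒m<n∨m≡n c≤M
      ... | inj₁ lt   = inj₂ (inner refl (s≤s z≤n) lt spc)
      ... | inj₂ refl = inj₁ (right e)

    module OneSided (i : ℕ) (I : Inner (g i)) where

      open Inner I

      next : Σ Bool λ s → g (suc i) ≡ rl c s
      next = neighbour-yy low high (subst (_~ g (suc i)) form (g-adj i))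

      prev : Σ Bool λ s → g (i + L) ≡ rl c s
      prev = neighbour-yy low high (subst (_~ g (i + L)) form (g-back i))

      two-sides : ∀ {s t u : Bool} → s ≢ t → u ≢ s → u ≢ t → ⊥
      two-sides {s} {t} {u} s≢t u≢s u≢t = s≢t (trans (¬-not (u≢s ∘ sym)) (sym (¬-not (u≢t ∘ sym))))

      -- The positions `i`, `suc i` and `i + L` already occupy all three vertices of column `c`.
      off-column : ∀ d → 2 ≤ d → d < L → col (g (i + d)) ≢ c
      off-column (suc zero) (s≤s ()) _ _
      off-column (suc (suc e)) _ d<L eq = go (g-good (i + d)) refl eq
        where
        d = suc (suc e)
        rest : i + d + (L ∸ d) ≡ i + L
        rest = trans (+-assoc i d _) (cong (i +_) (m+[n∸m]≡n (<⇒≤ d<L)))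
        go : ∀ {x} → Good x → g (i + d) ≡ x → col x ≡ c → ⊥
        go (good-lf _) e _ = no-leaf (i + d) e
        go (good-yy _ _ _) e refl = g-≢ i d (s≤s z≤n) (<⇒≤ d<L) (trans form (sym e))
        go (good-rl {s = s} _) e refl = two-sides
          (λ s≡t → g-ends-≢ i (trans (proj₂ next) (trans (cong (rl c) s≡t) (sym (proj₂ prev)))))
          (λ s≡ → g-≢ (suc i) (suc e′) (s≤s z≤n) (≤-trans (n≤1+n _) (<⇒≤ d<L))
                    (trans (proj₂ next) (trans (cong (rl c) (sym s≡)) (trans (sym e) (cong g (+-suc i (suc e′)))))))
          (λ s≡ → g-≢ (i + d) (L ∸ d) (m<n⇒0<n∸m d<L) (m∸n≤m L d)
                    (trans e (trans (cong (rl c) s≡) (trans (sym (proj₂ prev)) (cong g (sym rest))))))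
          where e′ = d ∸ 2

      side : (∀ e → 2 + e < L → col (g (i + (2 + e))) < c) ⊎
             (∀ e → 2 + e < L → c < col (g (i + (2 + e))))
      side with <-cmp (col (g (i + 2))) c
      ... | tri≈ _ eq _ = ⊥-elim (off-column 2 ≤-refl 3≤L eq)
      ... | tri< lt _ _ = inj₁ go
        where
        go : ∀ e → 2 + e < L → col (g (i + (2 + e))) < c
        go zero    _  = lt
        go (suc e) lL = subst (λ j → col (g j) < c) (sym (+-suc i (2 + e)))
          (proj₁ (no-jump (g-adj (i + (2 + e))) plain
            (subst (λ j → col (g j) ≢ c) (+-suc i (2 + e)) (off-column (3 + e) (s≤s (s≤s z≤n)) lL)))
            (go e (<⇒≤ lL)))
      ... | tri> _ _ gt = inj₂ go
        where
        go : ∀ e → 2 + e < L → c < col (g (i + (2 + e)))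
        go zero    _  = gt
        go (suc e) lL = subst (λ j → c < col (g j)) (sym (+-suc i (2 + e)))
          (proj₂ (no-jump (g-adj (i + (2 + e))) plain
            (subst (λ j → col (g j) ≢ c) (+-suc i (2 + e)) (off-column (3 + e) (s≤s (s≤s z≤n)) lL)))
            (go e (<⇒≤ lL)))

      private
        col-next : col (g (i + 1)) ≡ c
        col-next = trans (cong (col ∘ g) (+-comm i 1)) (cong col (proj₂ next))
        col-prev : col (g (i + L)) ≡ c
        col-prev = cong col (proj₂ prev)

        around : ∀ {P : ℕ → Set} → P c → (∀ e → 2 + e < L → P (col (g (i + (2 + e))))) →
                 ∀ d → 1 ≤ d → d ≤ L → P (col (g (i + d)))
        around {P} pc far (suc zero)    _ _ = subst P (sym col-next) pc
        around {P} pc far (suc (suc e)) _ d≤L with m≤n⇒m<n∨m≡n d≤L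
        ... | inj₁ lt = far e lt
        ... | inj₂ eq = subst (λ d → P (col (g (i + d)))) (sym eq) (subst P (sym col-prev) pc)

      one-sided : (∀ d → 1 ≤ d → d ≤ L → col (g (i + d)) ≤ c) ⊎
                  (∀ d → 1 ≤ d → d ≤ L → c ≤ col (g (i + d)))
      one-sided = Sum.map (λ far → around {λ x → x ≤ c} ≤-refl λ e lt → <⇒≤ (far e lt))
                      (λ far → around {λ x → c ≤ x} ≤-refl λ e lt → <⇒≤ (far e lt)) side

    -- The vertex charged for position i: an inner yy c is charged to the end of the
    -- ladder that the cycle cannot reach.
    data Rep (i : ℕ) : Label → Set where
      itself : Rail (g i) → Rep i (g i)
      toL    : (I : Inner (g i)) → (∀ d → 1 ≤ d → d ≤ L → Inner.c I ≤ col (g (i + d))) → Rep i (rl 0 true)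
      toR    : (I : Inner (g i)) → (∀ d → 1 ≤ d → d ≤ L → col (g (i + d)) ≤ Inner.c I) → Rep i (rl M true)

    rep : ∀ i → Σ Label (Rep i)
    rep i with classify i
    ... | inj₁ r = g i , itself r
    ... | inj₂ I with OneSided.one-sided i I
    ... | inj₁ below = rl M true , toR I below
    ... | inj₂ above = rl 0 true , toL I above

    rep-rail : ∀ {i x} → Rep i x → Rail x
    rep-rail (itself r) = r
    rep-rail (toL _ _)  = rail true z≤n
    rep-rail (toR _ _)  = rail true ≤-refl

    -- The numbers `d` and `d′` lead around the cycle from `i` to `j` and back. A charged end vertex
    -- lies strictly beyond the column bounding the cycle, so it is not on the cycle; two inner
    -- vertices charged to the same end bound each other's columns and therefore coincide.
    rep-≢ : ∀ {i j x y d d′} → 1 ≤ d → d ≤ L → 1 ≤ d′ → d′ ≤ L → g (i + d) ≡ g j → g (j + d′) ≡ g i →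
            Rep i x → Rep j y → x ≢ y
    rep-≢ {i} {j} {d = d} {d′} a b a′ b′ gj gi = go
      where
      same-column : (I : Inner (g i)) (J : Inner (g j)) → Inner.c I ≡ Inner.c J → ⊥
      same-column I J eq = g-≢ i d a b (trans (Inner.form I) (trans (cong yy eq) (trans (sym (Inner.form J)) (sym gj))))
      col-i : (I : Inner (g i)) → col (g (j + d′)) ≡ Inner.c I
      col-i I = trans (cong col gi) (cong col (Inner.form I))
      col-j : (J : Inner (g j)) → col (g (i + d)) ≡ Inner.c J
      col-j J = trans (cong col gj) (cong col (Inner.form J))
      go : ∀ {x y} → Rep i x → Rep j y → x ≢ y
      go (itself _) (itself _) eq = g-≢ i d a b (trans eq (sym gj))
      go (itself _) (toL J ab) eq = <⇒≱ (Inner.low J) (≤-trans (ab d′ a′ b′) (≤-reflexive (trans (cong col gi) (cong col eq))))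
      go (itself _) (toR J be) eq = <⇒≱ (Inner.high J) (≤-trans (≤-reflexive (sym (trans (cong col gi) (cong col eq)))) (be d′ a′ b′))
      go (toL I ab) (itself _) eq = <⇒≱ (Inner.low I) (≤-trans (ab d a b) (≤-reflexive (trans (cong col gj) (cong col (sym eq)))))
      go (toR I be) (itself _) eq = <⇒≱ (Inner.high I) (≤-trans (≤-reflexive (sym (trans (cong col gj) (cong col (sym eq))))) (be d a b))
      go (toL I ab) (toL J ab′) _ = same-column I J (≤-antisym
        (subst (Inner.c I ≤_) (col-j J) (ab d a b)) (subst (Inner.c J ≤_) (col-i I) (ab′ d′ a′ b′)))
      go (toR I be) (toR J be′) _ = same-column I J (≤-antisym
        (subst (_≤ Inner.c J) (col-i I) (be′ d′ a′ b′)) (subst (_≤ Inner.c I) (col-j J) (be d a b)))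
      go (toL _ _) (toR _ _) ()
      go (toR _ _) (toL _ _) ()

    no-cycle : ⊥
    -- There are `suc L` positions, but their representatives have only `L` codes.
    no-cycle with pigeonhole (n<1+n L) (λ i → fromℕ< (code-< (rep-rail (proj₂ (rep (toℕ i))))))
    ... | i , j , i<j , eq = rep-≢ {d = d} {suc L ∸ d} 1≤d d≤L (m<n⇒0<n∸m (s≤s d≤L)) (back d 1≤d) gj gi
            (proj₂ (rep (toℕ i))) (proj₂ (rep (toℕ j)))
            (code-injective (rep-rail (proj₂ (rep (toℕ i)))) (rep-rail (proj₂ (rep (toℕ j))))
              (trans (sym (toℕ-fromℕ< _)) (trans (cong toℕ eq) (toℕ-fromℕ< _))))
      where
      d = toℕ j ∸ toℕ i
      1≤d : 1 ≤ d
      1≤d = m<n⇒0<n∸m i<j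
      d≤L : d ≤ L
      d≤L = ≤-trans (m∸n≤m (toℕ j) (toℕ i)) (≤-pred (toℕ<n j))
      i+d : toℕ i + d ≡ toℕ j
      i+d = m+[n∸m]≡n (<⇒≤ i<j)
      back : ∀ d → 1 ≤ d → suc L ∸ d ≤ L
      back (suc d) _ = m∸n≤m L d
      gj : g (toℕ i + d) ≡ g (toℕ j)
      gj = cong g i+d
      gi : g (toℕ j + (suc L ∸ d)) ≡ g (toℕ i)
      gi = cong labelV (trans (cong at (trans (cong (_+ (suc L ∸ d)) (sym i+d))
             (trans (+-assoc (toℕ i) d _) (cong (toℕ i +_) (m+[n∸m]≡n (m≤n⇒m≤1+n d≤L))))))
             (at-period (toℕ i)))

-- Long paths between nonadjacent vertices of different parts.

dbl-+ : ∀ c d → dbl (c + d) ≡ dbl c + dbl d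
dbl-+ zero    d = refl
dbl-+ (suc c) d = cong (suc ∘ suc) (dbl-+ c d)

≢⇒≡not : ∀ {s t : Bool} → s ≢ t → t ≡ not s
≢⇒≡not ne = ¬-not (ne ∘ sym)

module Saturation (h m n : ℕ) (ε : Bool) (large : 2 + dbl h ≤ m) (room : suc m < n) where

  open Construction h m n ε large room
  open NoCycle h m n ε large room using (L)
  open Paths _~_ OK

  resize : ∀ {P x y a b} → a ≡ b → Path P x y a → Path P x y b
  resize refl p = p

  Add : Label → (Label → Set) → Label → Set
  Add a P b = b ≡ a ⊎ P b

  cons : ∀ {P a x y k} → OK a → a ~ x → ¬ P a → Path P x y k → Path (Add a P) a y (suc k)
  cons {P} {a} ok e a∉ p = join (point ok) e p (λ { refl q → a∉ q }) inj₁ inj₂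

  snoc : ∀ {P a x y k} → OK a → y ~ a → ¬ P a → Path P x y k → Path (Add a P) x a (suc k)
  snoc {k = k} ok e a∉ p = resize (+-comm k 1) (join p e (point ok) (λ { q refl → a∉ q }) inj₂ inj₁)

  wrap : ∀ {P R a b x y k} → OK a → OK b → a ~ x → y ~ b → ¬ P a → ¬ P b → a ≢ b →
         (∀ {z} → P z → R z) → R a → R b → Path P x y k → Path R a b (2 + k)
  wrap oka okb e f a∉ b∉ a≢b P⊆R ra rb p = relax
    (λ { (inj₁ refl) → rb ; (inj₂ (inj₁ refl)) → ra ; (inj₂ (inj₂ q)) → P⊆R q })
    (snoc okb f (λ { (inj₁ b≡a) → a≢b (sym b≡a) ; (inj₂ q) → b∉ q }) (cons oka e a∉ p))

  -- Rail vertices and the third vertex of the left (right) end column, i.e. the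
  -- vertices which a U-shaped cover of a left (right) part of the ladder may use.
  CoreL CoreR : Label → Set
  CoreL (rl _ _) = ⊤
  CoreL (yy c)   = c ≡ 0
  CoreL (lf _ _) = ⊥
  CoreR (rl _ _) = ⊤
  CoreR (yy c)   = c ≡ M
  CoreR (lf _ _) = ⊥

  Left Right LeftCore RightCore : ℕ → Label → Set
  Left i x      = col x ≤ i
  Right c x     = c ≤ col x
  LeftCore i x  = Left i x × CoreL x
  RightCore c x = Right c x × CoreR x

  rl≢ : ∀ {c s} → rl c s ≢ rl c (not s)
  rl≢ {s = true}  ()
  rl≢ {s = false} ()

  rung~ : ∀ c s → rl c s ~ rl c (not s)
  rung~ c true  = inj₂ (rung c)
  rung~ c false = inj₁ (rung c)

  tri~ : ∀ c s → yy c ~ rl c s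
  tri~ c s = inj₁ (tri c s)

  rail~ : ∀ c s → rl c s ~ rl (suc c) s
  rail~ c s = inj₂ (rail c s)

  link : ∀ c s t → sp c ≡ true ⊎ sp (suc c) ≡ true → rl c s ~ rl (suc c) t
  link c s t spec with s ≟ᵇ t
  ... | yes refl = rail~ c s
  ... | no s≢t   = inj₂ (subst (λ b → Own (rl (suc c) t) (rl c b)) (sym (≢⇒≡not (s≢t ∘ sym)))
                     (cross c t (or spec)))
    where
    or : sp c ≡ true ⊎ sp (suc c) ≡ true → sp c ∨ sp (suc c) ≡ true
    or (inj₁ e) rewrite e = refl
    or (inj₂ e) = trans (cong (sp c ∨_) e) (∨-zeroʳ (sp c))

  ok-yy₀ : OK (yy 0)
  ok-yy₀ = ok-yy z≤n refl (inj₁ (s≤s z≤n))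

  ok-yyM : ε ≡ true → OK (yy M)
  ok-yyM e = ok-yy ≤-refl M-plain (inj₂ e)

  -- The U grows by one column at its open end; `o` says whether its turn in column 0 passes through
  -- `yy 0`.
  coverL : ∀ i s o → i ≤ M → Path (LeftCore i) (rl i s) (rl i (not s)) ([ o ]? + (2 + dbl i))
  coverL zero s false _ = relax
    (λ { (inj₁ refl) → z≤n , tt ; (inj₂ refl) → z≤n , tt })
    (snoc (ok-rl z≤n) (rung~ 0 s) (λ eq → rl≢ (sym eq)) (point (ok-rl z≤n)))
  coverL zero s true _ = wrap (ok-rl z≤n) (ok-rl z≤n) (~-sym (tri~ 0 s)) (tri~ 0 (not s))
    (λ ()) (λ ()) rl≢ (λ { refl → z≤n , refl }) (z≤n , tt) (z≤n , tt) (point ok-yy₀)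
  coverL (suc i) s o i<M = resize (grow o)
    (wrap (ok-rl i<M) (ok-rl i<M) (~-sym (rail~ i s)) (rail~ i (not s))
      (<-irrefl refl ∘ proj₁) (<-irrefl refl ∘ proj₁) rl≢
      (λ { (le , core) → m≤n⇒m≤1+n le , core }) (≤-refl , tt) (≤-refl , tt) (coverL i s o (<⇒≤ i<M)))
    where
    grow : ∀ o → 2 + ([ o ]? + (2 + dbl i)) ≡ [ o ]? + (4 + dbl i)
    grow true  = refl
    grow false = refl

  -- The number of rail vertices in the columns from `c` to `M`, plus one if `yy M` exists.
  size : ℕ → ℕ
  size c = [ ε ]? + (2 + dbl (M ∸ c))

  size-suc : ∀ {c} → c < M → 2 + size (suc c) ≡ size c
  size-suc {c} c<M rewrite sym (suc-pred (M ∸ c) {{>-nonZero (m<n⇒0<n∸m c<M)}}) | pred[m∸n]≡m∸[1+n] M c =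
    solve 2 (λ e d → con 2 :+ (e :+ (con 2 :+ d)) := e :+ (con 4 :+ d)) refl [ ε ]? (dbl (M ∸ suc c))

  coverR′ : ∀ d {c} s → d + c ≡ M → Path (RightCore c) (rl c s) (rl c (not s)) (size c)
  coverR′ zero s refl = resize (cong (λ d → [ ε ]? + (2 + dbl d)) (sym (n∸n≡0 M))) (base ε refl)
    where
    base : ∀ b → ε ≡ b → Path (RightCore M) (rl M s) (rl M (not s)) ([ b ]? + 2)
    base false _ = relax (λ { (inj₁ refl) → ≤-refl , tt ; (inj₂ refl) → ≤-refl , tt })
      (snoc (ok-rl ≤-refl) (rung~ M s) (λ eq → rl≢ (sym eq)) (point (ok-rl ≤-refl)))
    base true e = wrap (ok-rl ≤-refl) (ok-rl ≤-refl) (~-sym (tri~ M s)) (tri~ M (not s))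
      (λ ()) (λ ()) rl≢ (λ { refl → ≤-refl , refl }) (≤-refl , tt) (≤-refl , tt) (point (ok-yyM e))
  coverR′ (suc d) {c} s eq = resize (size-suc c<M)
    (wrap (ok-rl (<⇒≤ c<M)) (ok-rl (<⇒≤ c<M)) (rail~ c s) (~-sym (rail~ c (not s)))
      (<-irrefl refl ∘ proj₁) (<-irrefl refl ∘ proj₁) rl≢
      (λ { (le , core) → <⇒≤ le , core }) (≤-refl , tt) (≤-refl , tt) (coverR′ d s (trans (+-suc d c) eq)))
    where
    c<M : c < M
    c<M = subst (c <_) eq (s≤s (m≤n+m c d))

  coverR : ∀ {c} s → c ≤ M → Path (RightCore c) (rl c s) (rl c (not s)) (size c)
  coverR {c} s c≤M = coverR′ (M ∸ c) s (m∸n+n≡m c≤M)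

  -- 3 + dbl i is the number of rail vertices in the columns ≤ i, plus one for yy 0;
  -- d tells whether the path has one vertex more.
  record From (u : Label) (i : ℕ) (x d : Bool) : Set where
    constructor from
    field
      {last} : Label
      body   : Path (Left i) u last ([ d ]? + (3 + dbl i))
      exit   : last ~ rl (suc i) x

  -- Here `x` is the rail on which column `c` is entered, and `e` says whether the right half holds
  -- the additional vertex.
  To : Label → ℕ → Bool → Bool → Set
  To v c x e = Path (Right c) (rl c x) v ([ e ]? + size c)

  -- The flags `not e` and `e` place the additional vertex in exactly one half, which gives one
  -- vertex more than `L`.
  meet : ∀ {u v i x} e → From u i x (not e) → To v (suc i) x e → i < M → Path (λ _ → ⊤) u v (suc L)
  meet {i = i} e (from p l) q i<M = resize (count e)
    (join p l q (λ l r → <⇒≱ r l) (λ _ → tt) (λ _ → tt))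
    where
    M≡ : dbl M ≡ 2 + (dbl i + dbl (M ∸ suc i))
    M≡ = trans (cong dbl (sym (m+[n∸m]≡n i<M))) (cong (suc ∘ suc) (dbl-+ i (M ∸ suc i)))
    count : ∀ e → ([ not e ]? + (3 + dbl i)) + ([ e ]? + size (suc i)) ≡ suc L
    count false rewrite M≡ = solve 3 (λ e a b → (con 4 :+ a) :+ (e :+ (con 2 :+ b))
      := con 1 :+ (e :+ (con 3 :+ (con 2 :+ (a :+ b))))) refl [ ε ]? (dbl i) (dbl (M ∸ suc i))
    count true  rewrite M≡ = solve 3 (λ e a b → (con 3 :+ a) :+ (con 1 :+ (e :+ (con 2 :+ b)))
      := con 1 :+ (e :+ (con 3 :+ (con 2 :+ (a :+ b))))) refl [ ε ]? (dbl i) (dbl (M ∸ suc i))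

  past : ∀ {v c y e} x → rl c (not x) ~ rl (suc c) y → c < M → To v (suc c) y e → To v c x e
  past {c = c} {e = e} x l c<M p = resize (grow e)
    (relax (λ { (inj₁ refl) → ≤-refl ; (inj₂ (inj₁ refl)) → ≤-refl ; (inj₂ (inj₂ r)) → <⇒≤ r })
      (cons (ok-rl (<⇒≤ c<M)) (rung~ c x) (λ { (inj₁ eq) → rl≢ eq ; (inj₂ r) → <-irrefl refl r })
        (cons (ok-rl (<⇒≤ c<M)) l (<-irrefl refl) p)))
    where
    grow : ∀ e → 2 + ([ e ]? + size (suc c)) ≡ [ e ]? + size c
    grow true  = cong suc (size-suc c<M)
    grow false = size-suc c<M

  -- Replacing the rung by the detour over `yy c` gains the additional vertex without changing the
  -- rails used.
  past-via : ∀ {v c y} x → rl c (not x) ~ rl (suc c) y → sp c ≡ false → c < M →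
             To v (suc c) y false → To v c x true
  past-via {c = c} x l spc c<M p = resize (cong suc (size-suc c<M))
    (relax (λ { (inj₁ refl) → ≤-refl ; (inj₂ (inj₁ refl)) → ≤-refl
              ; (inj₂ (inj₂ (inj₁ refl))) → ≤-refl ; (inj₂ (inj₂ (inj₂ r))) → <⇒≤ r })
      (cons (ok-rl (<⇒≤ c<M)) (~-sym (tri~ c x))
          (λ { (inj₁ ()) ; (inj₂ (inj₁ eq)) → rl≢ eq ; (inj₂ (inj₂ r)) → <-irrefl refl r })
        (cons (ok-yy (<⇒≤ c<M) spc (inj₁ c<M)) (tri~ c (not x)) (λ { (inj₁ ()) ; (inj₂ r) → <-irrefl refl r })
          (cons (ok-rl (<⇒≤ c<M)) l (<-irrefl refl) p))))

  -- Walking along a rail or across a rung both change the bit  x xor even c,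
  -- so a sweep that enters every column with a straight rail preserves it.
  ToColour : Label → ℕ → Bool → Bool → Set
  ToColour v c κ e = To v c (κ xor even c) e

  straight : ∀ c κ → rl c (not (κ xor even c)) ~ rl (suc c) (κ xor even (suc c))
  straight c κ = subst (λ y → rl c (not (κ xor even c)) ~ rl (suc c) y) (sym (xor-notʳ κ (even c))) (rail~ c _)

  sweep : ∀ {v c j} κ e → c ≤′ j → j ≤ M → ToColour v j κ e → ToColour v c κ e
  sweep κ e ≤′-refl _ p = p
  sweep {j = suc j} κ e (≤′-step c≤j) j<M p =
    sweep κ e c≤j (<⇒≤ j<M) (past {e = e} (κ xor even j) (straight j κ) j<M p)

  colour : ∀ {v c} x e → To v c x e → ToColour v c (x xor even c) e
  colour {v} {c} x e = subst (λ y → To v c y e) (sym (xor-cancelʳ x (even c)))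

  data RailL : Label → Set where
    rl : ∀ c s → RailL (rl c s)
    yy : RailL (yy 0)

  data RailR : Label → Set where
    rl : ∀ c s → RailR (rl c s)
    yy : ε ≡ true → RailR (yy M)

  -- The start `u` is not among the vertices of the U. Taking `o = d`, it either replaces `yy 0` in
  -- the count or comes on top of it.
  pad : ∀ {u i x d} → (∀ o → Path (Left i) u (rl i x) (suc ([ o ]? + (2 + dbl i)))) → From u i x d
  pad {i = i} {x} {true}  p = from (p true) (rail~ i x)
  pad {i = i} {x} {false} p = from (p false) (rail~ i x)

  sweepL : ∀ {u i} s o → OK u → Left i u → ¬ CoreL u → u ~ rl i s → i ≤ M →
           Path (Left i) u (rl i (not s)) (suc ([ o ]? + (2 + dbl i)))
  sweepL s o ok l ¬core e i≤M = relax (λ { (inj₁ refl) → l ; (inj₂ q) → proj₁ q })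
    (cons ok e (¬core ∘ proj₂) (coverL _ s o i≤M))

  from-yy : ∀ {i} x d → 1 ≤ i → i < M → sp i ≡ false → From (yy i) i x d
  from-yy {i} x d 1≤i i<M spi = pad λ o → subst (λ t → Path (Left i) (yy i) (rl i t) _) (not-involutive x)
    (sweepL (not x) o (ok-yy (<⇒≤ i<M) spi (inj₁ i<M)) ≤-refl (λ { refl → <⇒≱ 1≤i z≤n }) (tri~ i (not x)) (<⇒≤ i<M))

  from-rl : ∀ {i s x} → i < M → rl i (not s) ~ rl (suc i) x → From (rl i s) i x false
  from-rl {i} {s} i<M e = from (relax proj₁ (coverL i s true (<⇒≤ i<M))) e

  small : ∀ {P x y k} → Path P x y k → (∀ {a} → P a → col a ≡ 0) → Path (Left 0) x y k
  small p z = relax (≤-reflexive ∘ z) p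

  -- A start on a rail ends at `yy 0`, which sees both vertices of column 1; a start at `yy 0` may
  -- traverse the rung in either direction. So the exit rail is free.
  from-cap : ∀ {u} → RailL u → col u ≡ 0 → ∀ x → From u 0 x false
  from-cap (rl zero s) refl x = from {last = yy 0}
    (small (cons (ok-rl z≤n) (rung~ 0 s) (λ { (inj₁ eq) → rl≢ eq ; (inj₂ ()) })
        (cons (ok-rl z≤n) (~-sym (tri~ 0 (not s))) (λ ()) (point ok-yy₀)))
      (λ { (inj₁ refl) → refl ; (inj₂ (inj₁ refl)) → refl ; (inj₂ (inj₂ refl)) → refl }))
    (inj₁ (capL x))
  from-cap yy _ x = from
    (small (cons ok-yy₀ (tri~ 0 (not x)) (λ { (inj₁ ()) ; (inj₂ ()) })
        (cons (ok-rl z≤n) (subst (λ t → rl 0 (not x) ~ rl 0 t) (not-involutive x) (rung~ 0 (not x))) (λ eq → rl≢ (sym eq)) (point (ok-rl z≤n))))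
      (λ { (inj₁ refl) → refl ; (inj₂ (inj₁ refl)) → refl ; (inj₂ (inj₂ refl)) → refl }))
    (rail~ 0 x)

  -- With `d = false` the rail vertex opposite the host is dropped, so that the leaf takes its place
  -- in the count.
  from-cap-lf : ∀ {p a} s → col (lf p a) ≡ 0 → OK (lf p a) → lf p a ~ rl 0 s → ∀ x d → From (lf p a) 0 x d
  from-cap-lf s z ok e x true = from {last = yy 0}
    (small (cons ok e (λ { (inj₁ ()) ; (inj₂ (inj₁ ())) ; (inj₂ (inj₂ ())) })
        (cons (ok-rl z≤n) (rung~ 0 s) (λ { (inj₁ eq) → rl≢ eq ; (inj₂ ()) })
          (cons (ok-rl z≤n) (~-sym (tri~ 0 (not s))) (λ ()) (point ok-yy₀))))
      (λ { (inj₁ refl) → z ; (inj₂ (inj₁ refl)) → refl ; (inj₂ (inj₂ (inj₁ refl))) → refl ; (inj₂ (inj₂ (inj₂ refl))) → refl }))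
    (inj₁ (capL x))
  from-cap-lf s z ok e x false = from {last = yy 0}
    (small (cons ok e (λ { (inj₁ ()) ; (inj₂ ()) })
        (cons (ok-rl z≤n) (~-sym (tri~ 0 s)) (λ ()) (point ok-yy₀)))
      (λ { (inj₁ refl) → z ; (inj₂ (inj₁ refl)) → refl ; (inj₂ (inj₂ refl)) → refl }))
    (inj₁ (capL x))

  from-lf : ∀ p {a} x d → p < 3 + h → OK (lf p a) → From (lf p a) (col (lf p a)) x d
  from-lf 0 {a} x d _ ok = from-cap-lf true refl ok (inj₁ (hang 0 a)) x d
  from-lf 1 {a} x true _ ok = from
    (small (cons ok (inj₁ (hang 1 a)) (λ { (inj₁ ()) ; (inj₂ (inj₁ ())) ; (inj₂ (inj₂ ())) })
        (cons ok-yy₀ (tri~ 0 (not x)) (λ { (inj₁ ()) ; (inj₂ ()) })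
          (cons (ok-rl z≤n) (~-sym (rung~ 0 x)) (λ eq → rl≢ (sym eq)) (point (ok-rl z≤n)))))
      (λ { (inj₁ refl) → refl ; (inj₂ (inj₁ refl)) → refl ; (inj₂ (inj₂ (inj₁ refl))) → refl ; (inj₂ (inj₂ (inj₂ refl))) → refl }))
    (rail~ 0 x)
  from-lf 1 {a} x false _ ok = from
    (small (cons ok (inj₁ (hang 1 a)) (λ { (inj₁ ()) ; (inj₂ ()) })
        (cons ok-yy₀ (tri~ 0 x) (λ ()) (point (ok-rl z≤n))))
      (λ { (inj₁ refl) → refl ; (inj₂ (inj₁ refl)) → refl ; (inj₂ (inj₂ refl)) → refl }))
    (rail~ 0 x)
  from-lf 2 {a} x d _ ok = from-cap-lf false refl ok (inj₁ (hang 2 a)) x d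
  from-lf (suc (suc (suc p))) {a} x d (s≤s (s≤s (s≤s p<h))) ok = go d
    where
    i = dbl (suc p)
    i≤M : i ≤ M
    i≤M = ≤-trans (dbl-mono-≤ p<h) (≤-trans (≤-trans (m≤n+m (dbl h) 2) large) (n≤1+n m))
    body : ∀ o → Path (Left i) (lf (3 + p) a) (rl i false) (suc ([ o ]? + (2 + dbl i)))
    body o = sweepL true o ok ≤-refl id (inj₁ (hang (3 + p) a)) i≤M
    go : ∀ d → From (lf (3 + p) a) i x d
    go true  = from (body true) (link i false x (inj₁ (sp-dbl p<h)))
    go false = from (body false) (link i false x (inj₁ (sp-dbl p<h)))

  sp⇒<m : ∀ {c} → sp c ≡ true → suc c < M
  sp⇒<m {c} e = s≤s (≤-trans (s≤s (m≤n⇒m≤1+n (proj₂ (proj₂ (sp-elim c e))))) large)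

  sp≢ : ∀ {c} → sp c ≡ true → sp c ≡ false → ⊥
  sp≢ e e′ = true≢false (trans (sym e) e′)

  to-rl : ∀ {c} s → c ≤ M → To (rl c s) c (not s) false
  to-rl {c} s c≤M = subst (λ t → Path (Right c) (rl c (not s)) (rl c t) (size c)) (not-involutive s)
    (relax proj₁ (coverR (not s) c≤M))

  to-yyM : ε ≡ true → ∀ x → To (yy M) M x false
  to-yyM e x = resize (cong₂ (λ b d → [ b ]? + (2 + dbl d)) (sym e) (sym (n∸n≡0 M)))
    (relax (λ { (inj₁ refl) → ≤-refl ; (inj₂ (inj₁ refl)) → ≤-refl ; (inj₂ (inj₂ refl)) → ≤-refl })
      (snoc (ok-yyM e) (~-sym (tri~ M (not x))) (λ { (inj₁ ()) ; (inj₂ ()) })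
        (cons (ok-rl ≤-refl) (rung~ M x) rl≢ (point (ok-rl ≤-refl)))))

  to-railR : ∀ {v} → RailR v → col v ≤ M → Σ Bool λ x → To v (col v) x false
  to-railR (rl c s) c≤M = not s , to-rl s c≤M
  to-railR (yy e)   _   = true , to-yyM e true

  -- The vertex `yy j` is adjacent to both rails of its column, so the entry rail is free; it is
  -- itself the additional vertex.
  to-mid : ∀ {j} → j < M → sp j ≡ false → ∀ x → To (yy j) j x true
  to-mid {j} j<M spj x = resize (cong suc (size-suc j<M))
    (relax (λ { (inj₁ refl) → ≤-refl ; (inj₂ (inj₁ refl)) → ≤-refl
              ; (inj₂ (inj₂ (inj₁ refl))) → ≤-refl ; (inj₂ (inj₂ (inj₂ r))) → <⇒≤ (proj₁ r) })
      (snoc (ok-yy (<⇒≤ j<M) spj (inj₁ j<M)) (~-sym (tri~ j (not x)))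
          (λ { (inj₁ ()) ; (inj₂ (inj₁ ())) ; (inj₂ (inj₂ r)) → <-irrefl refl (proj₁ r) })
        (snoc (ok-rl (<⇒≤ j<M)) (~-sym (rail~ j (not x)))
            (λ { (inj₁ eq) → rl≢ (sym eq) ; (inj₂ r) → <-irrefl refl (proj₁ r) })
          (cons (ok-rl (<⇒≤ j<M)) (rail~ j x) (<-irrefl refl ∘ proj₁) (coverR x j<M)))))

  col≤M : ∀ {x} → Good x → col x ≤ M
  col≤M (good-rl c≤M)     = c≤M
  col≤M (good-yy c≤M _ _) = c≤M
  col≤M {lf p a} (good-lf p<) = ≤-trans (dbl-mono-≤ (≤-trans (∸-monoˡ-≤ 2 (≤-pred p<)) ≤-refl))
    (≤-trans (≤-trans (m≤n+m (dbl h) 2) large) (n≤1+n m))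

  -- The U must end at the host, which is on rail `true`; this forces the entry on rail `false`.
  to-lf : ∀ p {a} → p < h → OK (lf (3 + p) a) → To (lf (3 + p) a) (dbl (suc p)) false true
  to-lf p {a} p<h ok = relax (λ { (inj₁ refl) → ≤-refl ; (inj₂ r) → proj₁ r })
    (snoc ok (inj₂ (hang (3 + p) a)) proj₂ (coverR false (col≤M {lf (3 + p) a} (good-lf (+-monoʳ-≤ 3 p<h)))))

  from-railL : ∀ {u} → RailL u → col u < M → Σ Bool λ x → From u (col u) x false
  from-railL (rl i s) i<M = not s , from-rl i<M (rail~ i (not s))
  from-railL yy       _   = true , from-cap yy refl true

  from-any : ∀ {u} → RailL u → col u < M → col u ≡ 0 ⊎ (sp (col u) ≡ true ⊎ sp (suc (col u)) ≡ true) →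
             ∀ x → From u (col u) x false
  from-any yy       _   _          x = from-cap yy refl x
  from-any (rl i s) i<M (inj₂ spe) x = from-rl i<M (link i (not s) x spe)
  from-any (rl i s) i<M (inj₁ refl) x = from-cap (rl 0 s) refl x

  same-parity-part : ∀ {c d s t} → sp c ≡ false → sp d ≡ false → s xor even c ≡ t xor even d →
                     part (rl c s) ≡ part (rl d t)
  same-parity-part {c} {d} {s} {t} spc spd e =
    trans (part-plain-≡ c s spc) (trans (cong (λ b → if b then 0 else 1) e) (sym (part-plain-≡ d t spd)))

  -- No column lies strictly between such a pair to provide an additional vertex, so the pair has to
  -- be an edge already. The edges `cross`, `capL` and `capR` see to this.
  next-column : ∀ {u v} → RailL u → RailR v → col v ≡ suc (col u) → part u ≢ part v → u ~ v
  next-column (rl i s) (rl _ t) refl ne with s ≟ᵇ t | sp-dec i | sp-dec (suc i)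
  ... | yes refl | _      | _      = rail~ i s
  ... | no _     | inj₁ e | _      = link i s t (inj₁ e)
  ... | no _     | inj₂ _ | inj₁ e = link i s t (inj₂ e)
  ... | no s≢t   | inj₂ a | inj₂ b = ⊥-elim (ne (same-parity-part {i} {suc i} {s} {t} a b
    (trans (trans (sym (not-involutive _)) (sym (cong not (xor-notʳ s (even i)))))
      (trans (sym (xor-notˡ s (even (suc i)))) (cong (_xor even (suc i)) (sym (≢⇒≡not s≢t)))))))
  next-column (rl i s) (yy _) refl ne = inj₂ (capR s)
  next-column yy (rl _ t) refl ne = inj₁ (capL t)
  next-column yy (yy _) _ ne = ⊥-elim (ne refl)

  over-special : ∀ {u v} → RailL u → RailR v → col v ≡ suc (suc (col u)) → sp (suc (col u)) ≡ true →
                 part u ≢ part v → u ~ v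
  over-special (rl i s) (rl _ t) refl spe ne with s ≟ᵇ t
  ... | no s≢t = inj₂ (subst (λ b → Own (rl (2 + i) t) (rl i b)) (sym (≢⇒≡not (s≢t ∘ sym))) (jump (suc i) t spe))
  ... | yes refl = ⊥-elim (ne (same-parity-part {i} {2 + i} {s} {s} (sp-pred {i} spe) (sp-suc {suc i} spe)
    (cong (s xor_) (sym (even-suc-suc i)))))
  over-special (rl i s) (yy _) eq spe ne = ⊥-elim (<-irrefl (sym eq) (sp⇒<m spe))
  over-special yy _ _ () _

  -- All columns from that of `u` on are plain, so rail vertices in different parts have opposite
  -- colours. A U ends on the rail opposite to its start, hence the forced exit of `u` and the
  -- forced entry for `v` have the same colour. An endpoint `yy M` accepts either entry.
  matched : ∀ {u v} (U : RailL u) (V : RailR v) → sp (col u) ≡ false → sp (suc (col u)) ≡ false → 1 ≤ col u →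
            col u < col v → col v ≤ M → part u ≢ part v →
            Σ Bool λ κ → ToColour v (col v) κ false × From u (col u) (κ xor even (suc (col u))) false
  matched (rl i s) (rl j t) a b 1≤i i<j j≤M ne =
    s xor even i ,
    subst (λ x → To (rl j t) j x false) arrive (to-rl t j≤M) ,
    subst (λ x → From (rl i s) i x false) leave (from-rl i<M (rail~ i (not s)))
    where
    i<M = <-≤-trans i<j j≤M
    spj : sp j ≡ false
    spj = sp-pair 1≤i a b (<⇒≤ i<j)
    opposite : t xor even j ≡ not (s xor even i)
    opposite = ≢⇒≡not λ eq → ne (same-parity-part {i} {j} {s} {t} a spj eq)
    arrive : not t ≡ (s xor even i) xor even j
    arrive = trans (sym (xor-cancelʳ (not t) (even j)))
      (cong (_xor even j) (trans (xor-notˡ t (even j)) (trans (cong not opposite) (not-involutive _))))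
    leave : not s ≡ (s xor even i) xor even (suc i)
    leave = sym (trans (xor-notʳ (s xor even i) (even i)) (cong not (xor-cancelʳ s (even i))))
  matched (rl i s) (yy e) _ _ _ i<j _ _ =
    s xor even i , to-yyM e _ ,
    subst (λ x → From (rl i s) i x false) leave (from-rl i<j (rail~ i (not s)))
    where
    leave : not s ≡ (s xor even i) xor even (suc i)
    leave = sym (trans (xor-notʳ (s xor even i) (even i)) (cong not (xor-cancelʳ s (even i))))
  matched yy _ _ _ ()

  -- Neither endpoint is additional, so the detour over a third vertex is made in column `suc i`, or
  -- in column `2 + i` if `suc i` is special. Edges between consecutive columns, and over a special
  -- column, ensure that this detour lies strictly before `v`.
  rail-rail : ∀ {u v} → RailL u → RailR v → col u < col v → col v ≤ M → part u ≢ part v → ¬ u ~ v →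
              Path (λ _ → ⊤) u v (suc L)
  rail-rail {u} {v} U V i<j j≤M ne apart = go (sp-dec i) (sp-dec (suc i))
    where
    i = col u
    j = col v
    i<M : i < M
    i<M = <-≤-trans i<j j≤M
    i+2≤j : 2 + i ≤ j
    i+2≤j = ≤∧≢⇒< i<j λ eq → apart (next-column U V (sym eq) ne)
    1+i<M : suc i < M
    1+i<M = ≤-trans i+2≤j j≤M
    κ₀ : Bool
    κ₀ = proj₁ (to-railR V j≤M) xor even j
    base : ToColour v j κ₀ false
    base = colour (proj₁ (to-railR V j≤M)) false (proj₂ (to-railR V j≤M))
    via : ∀ κ {c} → sp c ≡ false → c < M → ToColour v (suc c) κ false → ToColour v c κ true
    via κ {c} spc c<M p = past-via (κ xor even c) (straight c κ) spc c<M p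
    go : sp i ≡ true ⊎ sp i ≡ false → sp (suc i) ≡ true ⊎ sp (suc i) ≡ false → Path (λ _ → ⊤) u v (suc L)
    go _ (inj₁ e) = meet true (from-any U i<M (inj₂ (inj₂ e)) _)
      (past {e = true} _ (straight (suc i) κ₀) 1+i<M
        (via κ₀ (sp-suc {suc i} e) (≤-trans i+3≤j j≤M) (sweep κ₀ false (≤⇒≤′ i+3≤j) j≤M base))) i<M
      where
      i+3≤j : 3 + i ≤ j
      i+3≤j = ≤∧≢⇒< i+2≤j λ eq → apart (over-special U V (sym eq) e ne)
    go (inj₁ e) (inj₂ b) = meet true (from-any U i<M (inj₂ (inj₁ e)) _)
      (via κ₀ b 1+i<M (sweep κ₀ false (≤⇒≤′ i+2≤j) j≤M base)) i<M
    go (inj₂ a) (inj₂ b) with m≤n⇒m<n∨m≡n (z≤n {i})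
    ... | inj₂ 0≡i = meet true (from-any U i<M (inj₁ (sym 0≡i)) _)
      (via κ₀ b 1+i<M (sweep κ₀ false (≤⇒≤′ i+2≤j) j≤M base)) i<M
    ... | inj₁ 1≤i with matched U V a b 1≤i i<j j≤M ne
    ... | κ , to , fr = meet true fr (via κ b 1+i<M (sweep κ false (≤⇒≤′ i+2≤j) j≤M to)) i<M

  -- The start is additional and has a free exit, so it adapts to the entry and the flag that `v`
  -- dictates.
  extra-left : ∀ {u v i j} → (∀ x d → From u i x d) → (Σ Bool λ e → Σ Bool λ x → To v j x e) →
               i < j → j ≤ M → Path (λ _ → ⊤) u v (suc L)
  extra-left {i = i} {j} fr (e , x , to) i<j j≤M =
    meet e (fr _ (not e)) (sweep (x xor even j) e (≤⇒≤′ i<j) j≤M (colour x e to)) (<-≤-trans i<j j≤M)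

  extra-mid : ∀ {u j} → RailL u → (∀ x → To (yy j) j x true) → col u < j → j ≤ M → Path (λ _ → ⊤) u (yy j) (suc L)
  extra-mid {u} {j} U to i<j j≤M with from-railL U (<-≤-trans i<j j≤M)
  ... | x , fr = meet true (subst (λ y → From u (col u) y false) (sym (xor-cancelʳ x (even (suc (col u))))) fr)
          (sweep (x xor even (suc (col u))) true (≤⇒≤′ i<j) j≤M (to _)) (<-≤-trans i<j j≤M)

  -- A leaf on the right forces its entry rail, so the exit on the left must be free. Two
  -- consecutive plain columns beyond column 0 would leave no special column further on.
  near-special : ∀ {i j} → i < j → sp j ≡ true → i ≡ 0 ⊎ (sp i ≡ true ⊎ sp (suc i) ≡ true)
  near-special {zero} _ _ = inj₁ refl
  near-special {suc i} {j} i<j spj with sp-dec (suc i) | sp-dec (2 + i)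
  ... | inj₁ e | _      = inj₂ (inj₁ e)
  ... | inj₂ _ | inj₁ e = inj₂ (inj₂ e)
  ... | inj₂ a | inj₂ b = ⊥-elim (sp≢ {j} spj (sp-pair (s≤s z≤n) a b (<⇒≤ i<j)))

  extra-lf : ∀ {u p a} → RailL u → p < h → OK (lf (3 + p) a) → col u < dbl (suc p) → dbl (suc p) ≤ M →
             Path (λ _ → ⊤) u (lf (3 + p) a) (suc L)
  extra-lf {u} {p} U p<h ok i<j j≤M =
    meet true (from-any U (<-≤-trans i<j j≤M) (near-special i<j (sp-dbl p<h)) _)
      (sweep (false xor even (dbl (suc p))) true (≤⇒≤′ i<j) j≤M (colour false true (to-lf p p<h ok))) (<-≤-trans i<j j≤M)

  data KindL (u : Label) : Set where
    rails : RailL u → KindL u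
    extra : (∀ x d → From u (col u) x d) → KindL u

  data KindR : Label → Set where
    rails : ∀ {v} → RailR v → KindR v
    mid   : ∀ {j} → (∀ x → To (yy j) j x true) → KindR (yy j)
    leaf  : ∀ p {a} → p < h → OK (lf (3 + p) a) → KindR (lf (3 + p) a)

  kindL : ∀ {u} → Good u → OK u → col u < M → KindL u
  kindL {rl c s}      _ _ _ = rails (rl c s)
  kindL {yy zero}     _ _ _ = rails yy
  kindL {yy (suc c)} (good-yy _ spc _) _ c<M = extra λ x d → from-yy x d (s≤s z≤n) c<M spc
  kindL {lf p a}     (good-lf p<) ok _ = extra λ x d → from-lf p x d p< ok

  kindR : ∀ {v} → Good v → OK v → 0 < col v → KindR v
  kindR {rl c s} _ _ _ = rails (rl c s)
  kindR {yy c} (good-yy _ spc (inj₁ c<M)) _ _ = mid (to-mid c<M spc)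
  kindR {yy c} (good-yy c≤M spc (inj₂ e)) _ _ with m≤n⇒m<n∨m≡n c≤M
  ... | inj₁ c<M  = mid (to-mid c<M spc)
  ... | inj₂ refl = rails (yy e)
  kindR {lf 0 a} _ _ ()
  kindR {lf 1 a} _ _ ()
  kindR {lf 2 a} _ _ ()
  kindR {lf (suc (suc (suc p))) a} (good-lf (s≤s (s≤s (s≤s p<h)))) ok _ = leaf p p<h ok

  ahead : ∀ {u v} → Good u → Good v → OK u → OK v → col u < col v → part u ≢ part v → ¬ u ~ v →
          Path (λ _ → ⊤) u v (suc L)
  ahead gu gv oku okv i<j ne apart =
    go (kindL gu oku (<-≤-trans i<j j≤M)) (kindR gv okv (≤-<-trans z≤n i<j)) i<j j≤M ne apart
    where
    j≤M = col≤M gv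
    go : ∀ {u v} → KindL u → KindR v → col u < col v → col v ≤ M → part u ≢ part v → ¬ u ~ v →
         Path (λ _ → ⊤) u v (suc L)
    go (rails U) (rails V)       i<j j≤M ne apart = rail-rail U V i<j j≤M ne apart
    go (rails U) (mid to)        i<j j≤M _  _     = extra-mid U to i<j j≤M
    go (rails U) (leaf p p<h ok) i<j j≤M _  _     = extra-lf U p<h ok i<j j≤M
    go (extra fr) (rails V)      i<j j≤M _  _     = extra-left fr (false , to-railR V j≤M) i<j j≤M
    go (extra fr) (mid to)       i<j j≤M _  _     = extra-left fr (true , true , to true) i<j j≤M
    go (extra fr) (leaf p p<h ok) i<j j≤M _ _     = extra-left fr (true , false , to-lf p p<h ok) i<j j≤M

  -- Pairs in the same column.

  around : ∀ s → Path (RightCore 1) (rl 1 s) (rl 1 (not s)) (size 1)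
  around s = coverR s (s≤s z≤n)

  -- The columns from 1 on are covered by a U; the four other vertices come from column 0 and its
  -- leaves.
  size-1 : 4 + size 1 ≡ suc L
  size-1 = solve 2 (λ e d → con 4 :+ (e :+ (con 2 :+ d)) := con 1 :+ (e :+ (con 3 :+ (con 2 :+ d)))) refl [ ε ]? (dbl m)

  full : ∀ {P x y} → Path P x y (4 + size 1) → Path (λ _ → ⊤) x y (suc L)
  full p = resize size-1 (relax (λ _ → tt) p)

  lf₀-yy : ∀ {a} → OK (lf 0 a) → Path (λ _ → ⊤) (lf 0 a) (yy 0) (suc L)
  lf₀-yy {a} ok = full
    (snoc ok-yy₀ (~-sym (inj₁ (capL true))) (λ { (inj₁ ()) ; (inj₂ (inj₁ ())) ; (inj₂ (inj₂ (inj₁ ()))) ; (inj₂ (inj₂ (inj₂ (() , _)))) })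
      (cons ok (inj₁ (hang 0 a)) (λ { (inj₁ ()) ; (inj₂ (inj₁ ())) ; (inj₂ (inj₂ (() , _))) })
        (cons (ok-rl z≤n) (rung~ 0 true) (λ { (inj₁ ()) ; (inj₂ (() , _)) })
          (cons (ok-rl z≤n) (rail~ 0 false) (λ { (() , _) }) (around false)))))

  lf₁-rl : ∀ {a} → OK (lf 1 a) → Path (λ _ → ⊤) (lf 1 a) (rl 0 false) (suc L)
  lf₁-rl {a} ok = full
    (snoc (ok-rl z≤n) (~-sym (rail~ 0 false)) (λ { (inj₁ ()) ; (inj₂ (inj₁ ())) ; (inj₂ (inj₂ (inj₁ ()))) ; (inj₂ (inj₂ (inj₂ (() , _)))) })
      (cons ok (inj₁ (hang 1 a)) (λ { (inj₁ ()) ; (inj₂ (inj₁ ())) ; (inj₂ (inj₂ (() , _))) })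
        (cons ok-yy₀ (tri~ 0 true) (λ { (inj₁ ()) ; (inj₂ (() , _)) })
          (cons (ok-rl z≤n) (rail~ 0 true) (λ { (() , _) }) (around true)))))

  lf₂-rl : ∀ {a} → OK (lf 2 a) → Path (λ _ → ⊤) (lf 2 a) (rl 0 true) (suc L)
  lf₂-rl {a} ok = full
    (snoc (ok-rl z≤n) (~-sym (rail~ 0 true)) (λ { (inj₁ ()) ; (inj₂ (inj₁ ())) ; (inj₂ (inj₂ (inj₁ ()))) ; (inj₂ (inj₂ (inj₂ (() , _)))) })
      (cons ok (inj₁ (hang 2 a)) (λ { (inj₁ ()) ; (inj₂ (inj₁ ())) ; (inj₂ (inj₂ (() , _))) })
        (cons (ok-rl z≤n) (~-sym (tri~ 0 false)) (λ { (inj₁ ()) ; (inj₂ (() , _)) })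
          (cons ok-yy₀ (inj₁ (capL false)) (λ { (() , _) }) (around false)))))

  lf-lf : ∀ {p q a b x y} s → p ≢ q → OK (lf p a) → OK (lf q b) → OK x → OK y → col x ≡ 0 → col y ≡ 0 →
          lf p a ~ x → lf q b ~ y → x ~ rl 1 s → y ~ rl 1 (not s) → x ≢ y →
          (∀ p a → lf p a ≢ x) → (∀ p a → lf p a ≢ y) → Path (λ _ → ⊤) (lf p a) (lf q b) (suc L)
  lf-lf {x = x} {y} s p≢q okp okq okx oky x₀ y₀ p~x q~y x~ y~ x≢y lf≢x lf≢y = full
    (snoc okq (~-sym q~y)
        (λ { (inj₁ refl) → p≢q refl ; (inj₂ (inj₁ eq)) → lf≢y _ _ eq ; (inj₂ (inj₂ (inj₁ eq))) → lf≢x _ _ eq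
           ; (inj₂ (inj₂ (inj₂ (_ , ())))) })
      (cons okp p~x (λ { (inj₁ eq) → lf≢y _ _ eq ; (inj₂ (inj₁ eq)) → lf≢x _ _ eq ; (inj₂ (inj₂ (_ , ()))) })
        (snoc oky (~-sym y~) (λ { (inj₁ eq) → x≢y (sym eq) ; (inj₂ (le , _)) → <⇒≱ le (≤-reflexive y₀) })
          (cons okx x~ (λ { (le , _) → <⇒≱ le (≤-reflexive x₀) }) (around s)))))

  Linked : Label → Label → Set
  Linked u v = Path (λ _ → ⊤) u v (suc L) ⊎ Path (λ _ → ⊤) v u (suc L)

  -- In a special column the leaf is adjacent to its host, shares its part with the other rail
  -- vertex and meets no third vertex; only column 0 requires paths.
  level-lf : ∀ p {a v} → Good (lf p a) → Good v → OK (lf p a) → OK v → dbl (p ∸ 2) ≡ col v →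
             p ≢ part v → ¬ lf p a ~ v → Linked (lf p a) v
  level-lf 0 {a} {rl _ true}  _ _ _ _ refl _ apart = ⊥-elim (apart (inj₁ (hang 0 a)))
  level-lf 0 {a} {rl _ false} _ _ _ _ refl ne _    = ⊥-elim (ne refl)
  level-lf 1 {a} {rl _ true}  _ _ _ _ refl ne _    = ⊥-elim (ne refl)
  level-lf 1 {a} {rl _ false} _ _ ok _ refl _ _    = inj₁ (lf₁-rl ok)
  level-lf 2 {a} {rl _ true}  _ _ ok _ refl _ _    = inj₁ (lf₂-rl ok)
  level-lf 2 {a} {rl _ false} _ _ _ _ refl _ apart = ⊥-elim (apart (inj₁ (hang 2 a)))
  level-lf 0 {a} {yy _} _ _ ok _ refl _ _    = inj₁ (lf₀-yy ok)
  level-lf 1 {a} {yy _} _ _ _ _ refl _ apart = ⊥-elim (apart (inj₁ (hang 1 a)))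
  level-lf 2 {a} {yy _} _ _ _ _ refl ne _    = ⊥-elim (ne refl)
  level-lf (suc (suc (suc p))) {a} {rl _ true}  _ _ _ _ refl _ apart = ⊥-elim (apart (inj₁ (hang (3 + p) a)))
  level-lf (suc (suc (suc p))) {a} {rl _ false} (good-lf (s≤s (s≤s (s≤s p<h)))) _ _ _ refl ne _ = ⊥-elim (ne (sym same))
    where
    same : part (rl (dbl (suc p)) false) ≡ 3 + p
    same rewrite sp-dbl p<h | ⌊dbl/2⌋ p = refl
  level-lf (suc (suc (suc p))) {a} {yy _} (good-lf (s≤s (s≤s (s≤s p<h)))) (good-yy _ spc _) _ _ refl _ _ =
    ⊥-elim (sp≢ {dbl (suc p)} (sp-dbl p<h) spc)
  level-lf 0 {a} {lf 0 b} _ _ _ _ _ ne _ = ⊥-elim (ne refl)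
  level-lf 0 {a} {lf 1 b} _ _ okp okq _ _ _ = inj₁ (lf-lf true (λ ()) okp okq (ok-rl z≤n) ok-yy₀ refl refl
    (inj₁ (hang 0 a)) (inj₁ (hang 1 b)) (rail~ 0 true) (inj₁ (capL false)) (λ ()) (λ _ _ ()) (λ _ _ ()))
  level-lf 0 {a} {lf 2 b} _ _ okp okq _ _ _ = inj₁ (lf-lf true (λ ()) okp okq (ok-rl z≤n) (ok-rl z≤n) refl refl
    (inj₁ (hang 0 a)) (inj₁ (hang 2 b)) (rail~ 0 true) (rail~ 0 false) (λ ()) (λ _ _ ()) (λ _ _ ()))
  level-lf 1 {a} {lf 0 b} _ _ okp okq _ _ _ = inj₂ (lf-lf true (λ ()) okq okp (ok-rl z≤n) ok-yy₀ refl refl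
    (inj₁ (hang 0 b)) (inj₁ (hang 1 a)) (rail~ 0 true) (inj₁ (capL false)) (λ ()) (λ _ _ ()) (λ _ _ ()))
  level-lf 1 {a} {lf 1 b} _ _ _ _ _ ne _ = ⊥-elim (ne refl)
  level-lf 1 {a} {lf 2 b} _ _ okp okq _ _ _ = inj₁ (lf-lf true (λ ()) okp okq ok-yy₀ (ok-rl z≤n) refl refl
    (inj₁ (hang 1 a)) (inj₁ (hang 2 b)) (inj₁ (capL true)) (rail~ 0 false) (λ ()) (λ _ _ ()) (λ _ _ ()))
  level-lf 2 {a} {lf 0 b} _ _ okp okq _ _ _ = inj₂ (lf-lf true (λ ()) okq okp (ok-rl z≤n) (ok-rl z≤n) refl refl
    (inj₁ (hang 0 b)) (inj₁ (hang 2 a)) (rail~ 0 true) (rail~ 0 false) (λ ()) (λ _ _ ()) (λ _ _ ()))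
  level-lf 2 {a} {lf 1 b} _ _ okp okq _ _ _ = inj₂ (lf-lf true (λ ()) okq okp ok-yy₀ (ok-rl z≤n) refl refl
    (inj₁ (hang 1 b)) (inj₁ (hang 2 a)) (inj₁ (capL true)) (rail~ 0 false) (λ ()) (λ _ _ ()) (λ _ _ ()))
  level-lf 2 {a} {lf 2 b} _ _ _ _ _ ne _ = ⊥-elim (ne refl)
  level-lf 0 {v = lf (suc (suc (suc q))) b} _ _ _ _ () _ _
  level-lf 1 {v = lf (suc (suc (suc q))) b} _ _ _ _ () _ _
  level-lf 2 {v = lf (suc (suc (suc q))) b} _ _ _ _ () _ _
  level-lf (suc (suc (suc p))) {v = lf 0 b} _ _ _ _ () _ _
  level-lf (suc (suc (suc p))) {v = lf 1 b} _ _ _ _ () _ _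
  level-lf (suc (suc (suc p))) {v = lf 2 b} _ _ _ _ () _ _
  level-lf (suc (suc (suc p))) {v = lf (suc (suc (suc q))) b} _ _ _ _ eq ne _ =
    ⊥-elim (ne (cong (2 +_) (dbl-injective eq)))

  level : ∀ {u v} → Good u → Good v → OK u → OK v → col u ≡ col v → part u ≢ part v → ¬ u ~ v → Linked u v
  level {lf p a} gu gv ou ov eq ne apart = level-lf p gu gv ou ov eq ne apart
  level {u} {lf q b} gu gv ou ov eq ne apart =
    swap (level-lf q gv gu ov ou (sym eq) (ne ∘ sym) (apart ∘ ~-sym))
  level {rl c s} {rl _ t} _ _ _ _ refl ne apart with s ≟ᵇ t
  ... | yes refl = ⊥-elim (ne refl)
  ... | no s≢t   = ⊥-elim (apart (subst (λ b → rl c s ~ rl c b) (sym (≢⇒≡not s≢t)) (rung~ c s)))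
  level {rl c s} {yy _} _ _ _ _ refl _ apart = ⊥-elim (apart (~-sym (tri~ c s)))
  level {yy c} {rl _ s} _ _ _ _ refl _ apart = ⊥-elim (apart (tri~ c s))
  level {yy c} {yy _}   _ _ _ _ refl ne _    = ⊥-elim (ne refl)

  linked : ∀ {u v} → Good u → Good v → OK u → OK v → part u ≢ part v → ¬ u ~ v → Linked u v
  linked {u} {v} gu gv ou ov ne apart with <-cmp (col u) (col v)
  ... | tri< lt _ _ = inj₁ (ahead gu gv ou ov lt ne apart)
  ... | tri≈ _ eq _ = level gu gv ou ov eq ne apart
  ... | tri> _ _ gt = inj₂ (ahead gv gu ov ou gt (ne ∘ sym) (apart ∘ ~-sym))

  open Close {_~_ = _~_} labelV labelV-injective

  saturated : ∀ u v → KAdj u v → H u v ≡ false → ContainsCycle (suc L) (addEdge H u v)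
  saturated u v uv no-edge = finish (linked (good (labelV-spec u)) (good (labelV-spec v)) (u , refl) (v , refl)
    (λ eq → uv (toℕ-injective (trans (sym (part≡ (labelV-spec u))) (trans eq (part≡ (labelV-spec v))))))
    (λ e → true≢false (trans (sym (~⇒adj e)) no-edge)))
    where
    open Labelled
    old : ∀ a b → labelV a ~ labelV b → addEdge H u v a b ≡ true
    old a b e rewrite ~⇒adj e = refl
    same : ∀ (w : V (3 + h) n) → ⌊ w ≟V w ⌋ ≡ true
    same w with w ≟V w
    ... | yes _ = refl
    ... | no w≢w = ⊥-elim (w≢w refl)
    finish : Linked (labelV u) (labelV v) → ContainsCycle (suc L) (addEdge H u v)
    finish (inj₁ p) = close {u = u} {v} old back p
      where
      back : addEdge H u v v u ≡ true
      back rewrite same v | same u = trans (cong (H v u ∨_) (∨-zeroʳ _)) (∨-zeroʳ (H v u))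
    finish (inj₂ p) = close {u = v} {u} old back p
      where
      back : addEdge H u v u v ≡ true
      back rewrite same v | same u = ∨-zeroʳ (H u v)

-- Counting edges by their owners.

∨-≤-+ : ∀ a b → [ a ∨ b ]? ≤ [ a ]? + [ b ]?
∨-≤-+ true  _ = s≤s z≤n
∨-≤-+ false _ = ≤-refl

[]?≤1 : ∀ b → [ b ]? ≤ 1
[]?≤1 true  = ≤-refl
[]?≤1 false = z≤n

module EdgeCount (h m n : ℕ) (ε : Bool) (large : 2 + dbl h ≤ m) (room : suc m < n) where

  open Construction h m n ε large room

  private
    k : ℕ
    k = 3 + h
    W : List (V k n)
    W = allV k n

  own : V k n → V k n → ℕ
  own u v = [ member (labelV v) (outs (labelV u)) ]?

  -- A label determines part and position, so its indicator is bounded by a product of one indicator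
  -- per coordinate.
  count-label : ∀ x → ∑ W (λ v → [ ⌊ labelV v ≟L x ⌋ ]?) ≤ 1
  count-label x = begin
    ∑ W (λ v → [ ⌊ labelV v ≟L x ⌋ ]?)
      ≡⟨ ∑-allV k n _ ⟩
    ∑ (allFin k) (λ i → ∑ (allFin n) (λ a → [ ⌊ labelV (i , a) ≟L x ⌋ ]?))
      ≤⟨ ∑-mono (allFin k) (λ i → ∑-mono (allFin n) (λ a → coordinates i a)) ⟩
    ∑ (allFin k) (λ i → ∑ (allFin n) (λ a → [ toℕ i ≡ᵇ part x ]? * [ toℕ a ≡ᵇ pos x ]?))
      ≡⟨ ∑-cong (allFin k) (λ i → ∑-*ˡ (allFin n) _ [ toℕ i ≡ᵇ part x ]?) ⟩
    ∑ (allFin k) (λ i → [ toℕ i ≡ᵇ part x ]? * ∑ (allFin n) (λ a → [ toℕ a ≡ᵇ pos x ]?))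
      ≡⟨ ∑-*ʳ (allFin k) (λ i → [ toℕ i ≡ᵇ part x ]?) _ ⟩
    ∑ (allFin k) (λ i → [ toℕ i ≡ᵇ part x ]?) * ∑ (allFin n) (λ a → [ toℕ a ≡ᵇ pos x ]?)
      ≤⟨ *-mono-≤ (∑-≡ᵇ k (part x)) (∑-≡ᵇ n (pos x)) ⟩
    1 ∎
    where
    open ≤-Reasoning
    coordinates : ∀ i a → [ ⌊ labelV (i , a) ≟L x ⌋ ]? ≤ [ toℕ i ≡ᵇ part x ]? * [ toℕ a ≡ᵇ pos x ]?
    coordinates i a with labelV (i , a) ≟L x
    ... | no _  = z≤n
    ... | yes eq
      rewrite T⇒≡true (≡⇒≡ᵇ (toℕ i) (part x) (trans (sym (Labelled.part≡ (labelV-spec (i , a)))) (cong part eq)))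
            | T⇒≡true (≡⇒≡ᵇ (toℕ a) (pos x) (trans (sym (Labelled.pos≡ (labelV-spec (i , a)))) (cong pos eq))) = ≤-refl

  count-member : ∀ xs → ∑ W (λ v → [ member (labelV v) xs ]?) ≤ length xs
  count-member []       = ≤-reflexive (trans (∑-const W 0) (*-zeroʳ (length W)))
  count-member (x ∷ xs) = begin
    ∑ W (λ v → [ member (labelV v) (x ∷ xs) ]?)
      ≤⟨ ∑-mono W (λ v → ∨-≤-+ ⌊ labelV v ≟L x ⌋ _) ⟩
    ∑ W (λ v → [ ⌊ labelV v ≟L x ⌋ ]? + [ member (labelV v) xs ]?)
      ≡⟨ ∑-+ W _ _ ⟩
    ∑ W (λ v → [ ⌊ labelV v ≟L x ⌋ ]?) + ∑ W (λ v → [ member (labelV v) xs ]?)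
      ≤⟨ +-mono-≤ (count-label x) (count-member xs) ⟩
    suc (length xs) ∎
    where open ≤-Reasoning

  -- Each vertex is granted one owned edge, which is all that a leaf owns; this is the surplus of
  -- the others.
  excess : Label → ℕ
  excess x = length (outs x) ∸ 1

  column-excess : ℕ → ℕ
  column-excess a = excess (rl a true) + excess (rl a false) + excess (yy a)

  -- A ladder column gets 2 for its rung and triangle. The 4 pays for `cross` and `jump` edges, at
  -- most two per rail vertex, and in column 0 for `capL`; the last 2 pays for `capR`.
  budget : ℕ → ℕ
  budget a = 2 * [ a <ᵇ suc M ]? + (4 * [ a <ᵇ 2 + dbl h ]? + 2 * [ a ≡ᵇ M ]?)

  private
    length-when : ∀ b x → length (when b x) ≡ [ b ]?
    length-when true  x = refl
    length-when false x = refl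

    near : ℕ → ℕ
    near c = [ sp c ∨ sp (suc c) ]? + [ sp c ]?

    length-links : ∀ c s → length (when (sp c ∨ sp (suc c)) (rl c s) ++ when (sp c) (rl (pred c) s)) ≡ near c
    length-links c s = trans (length-++ (when (sp c ∨ sp (suc c)) (rl c s)))
      (cong₂ _+_ (length-when (sp c ∨ sp (suc c)) (rl c s)) (length-when (sp c) (rl (pred c) s)))

    beyond : ∀ c → (suc c <ᵇ 2 + dbl h) ≡ false → dbl h < c
    beyond c e = ≰⇒> λ c≤ → true≢false (trans (sym (T⇒≡true (<⇒<ᵇ (s≤s (s≤s c≤))))) e)

    near-≤ : ∀ c → near c ≤ 2 * [ suc c <ᵇ 2 + dbl h ]?
    near-≤ c with suc c <ᵇ 2 + dbl h in eq
    ... | true  = +-mono-≤ ([]?≤1 (sp c ∨ sp (suc c))) ([]?≤1 (sp c))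
    ... | false rewrite sp-> {c} (beyond c eq) | sp-> {suc c} (m<n⇒m<1+n (beyond c eq)) = z≤n

    length-ends : ∀ c → length (ends (suc c)) ≡ 2 * [ c ≡ᵇ m ]?
    length-ends c with c ≡ᵇ m
    ... | true  = refl
    ... | false = refl

  column-excess-≤ : ∀ a → a ≤ M → column-excess a ≤ budget a
  column-excess-≤ zero    _ = s≤s (s≤s (s≤s z≤n))
  column-excess-≤ (suc c) c<M
    rewrite length-links c false | length-links c true | length-ends c
          | T⇒≡true (<⇒<ᵇ (s≤s c<M)) = begin
    near c + suc (near c) + suc e
      ≡⟨ solve 2 (λ a b → a :+ (con 1 :+ a) :+ (con 1 :+ b) := con 2 :+ (con 2 :* a :+ b)) refl (near c) e ⟩
    2 + (2 * near c + e)
      ≤⟨ +-monoʳ-≤ 2 (+-monoˡ-≤ e (*-monoʳ-≤ 2 (near-≤ c))) ⟩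
    2 + (2 * (2 * [ suc c <ᵇ 2 + dbl h ]?) + e)
      ≡⟨ cong (λ x → 2 + (x + e)) (sym (*-assoc 2 2 [ suc c <ᵇ 2 + dbl h ]?)) ⟩
    2 + (4 * [ suc c <ᵇ 2 + dbl h ]? + e) ∎
    where
    open ≤-Reasoning
    e = 2 * [ c ≡ᵇ m ]?

  -- Surplus is charged only to the part of the label, so summing over all parts collects the
  -- surplus of a column at most once.
  share : ℕ → Label → ℕ
  share p x = [ p ≡ᵇ part x ]? * excess x

  column-share : ℕ → ℕ → ℕ
  column-share p a = share p (rl a true) + share p (rl a false) + share p (yy a)

  private
    ≤-1+∸1 : ∀ x → x ≤ 1 + (x ∸ 1)
    ≤-1+∸1 zero    = z≤n
    ≤-1+∸1 (suc x) = ≤-refl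

    outs-≤ : ∀ {x p} → part x ≡ p → length (outs x) ≤ 1 + share p x
    outs-≤ {x} refl rewrite T⇒≡true (≡⇒≡ᵇ (part x) (part x) refl) | *-identityˡ (excess x) = ≤-1+∸1 (length (outs x))

  outs-label : ∀ p a → p < k → length (outs (label p a)) ≤ 1 + [ a <ᵇ suc M ]? * column-share p a
  outs-label p a p< = go (label-spec p a p<)
    where
    within : ∀ {x b s} → b ≤ M → x ≤ 1 + s → s ≤ column-share p b → x ≤ 1 + [ b <ᵇ suc M ]? * column-share p b
    within {b = b} b≤M x≤ s≤ rewrite T⇒≡true (<⇒<ᵇ (s≤s b≤M)) | *-identityˡ (column-share p b) =
      ≤-trans x≤ (s≤s s≤)
    go : ∀ {x b} → Labelled p b x → length (outs x) ≤ 1 + [ b <ᵇ suc M ]? * column-share p b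
    go {rl b true}  (labelled pa refl (good-rl b≤M)) = within b≤M (outs-≤ {rl b true} pa)
      (≤-trans (m≤m+n _ _) (m≤m+n _ (share p (yy b))))
    go {rl b false} (labelled pa refl (good-rl b≤M)) = within b≤M (outs-≤ {rl b false} pa)
      (≤-trans (m≤n+m _ (share p (rl b true))) (m≤m+n _ (share p (yy b))))
    go {yy b} (labelled pa refl (good-yy b≤M _ _)) = within b≤M (outs-≤ {yy b} pa)
      (m≤n+m (share p (yy b)) (share p (rl b true) + share p (rl b false)))
    go {lf _ b} (labelled _ refl _) = s≤s z≤n

  ∑-column-share : ∀ a → ∑ (allFin k) (λ i → column-share (toℕ i) a) ≤ column-excess a
  ∑-column-share a = begin
    ∑ (allFin k) (λ i → column-share (toℕ i) a)
      ≡⟨ ∑-+ (allFin k) (λ i → share (toℕ i) (rl a true) + share (toℕ i) (rl a false)) (λ i → share (toℕ i) (yy a)) ⟩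
    ∑ (allFin k) (λ i → share (toℕ i) (rl a true) + share (toℕ i) (rl a false)) + ∑ (allFin k) (λ i → share (toℕ i) (yy a))
      ≡⟨ cong (_+ ∑ (allFin k) (λ i → share (toℕ i) (yy a)))
           (∑-+ (allFin k) (λ i → share (toℕ i) (rl a true)) (λ i → share (toℕ i) (rl a false))) ⟩
    ∑ (allFin k) (λ i → share (toℕ i) (rl a true)) + ∑ (allFin k) (λ i → share (toℕ i) (rl a false))
      + ∑ (allFin k) (λ i → share (toℕ i) (yy a))
      ≤⟨ +-mono-≤ (+-mono-≤ (total (rl a true)) (total (rl a false))) (total (yy a)) ⟩
    column-excess a ∎
    where
    open ≤-Reasoning
    total : ∀ x → ∑ (allFin k) (λ i → share (toℕ i) x) ≤ excess x
    total x = begin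
      ∑ (allFin k) (λ i → [ toℕ i ≡ᵇ part x ]? * excess x)   ≡⟨ ∑-*ʳ (allFin k) (λ i → [ toℕ i ≡ᵇ part x ]?) (excess x) ⟩
      ∑ (allFin k) (λ i → [ toℕ i ≡ᵇ part x ]?) * excess x   ≤⟨ *-monoˡ-≤ (excess x) (∑-≡ᵇ k (part x)) ⟩
      1 * excess x                                            ≡⟨ *-identityˡ (excess x) ⟩
      excess x                                                ∎

  extra : ℕ
  extra = 2 * suc M + (4 * (2 + dbl h) + 2 * 1)

  ∑-budget : ∑ (allFin n) (λ a → budget (toℕ a)) ≤ extra
  ∑-budget = begin
    ∑ F (λ a → 2 * A₁ a + (4 * A₂ a + 2 * A₃ a))
      ≡⟨ ∑-+ F (λ a → 2 * A₁ a) (λ a → 4 * A₂ a + 2 * A₃ a) ⟩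
    ∑ F (λ a → 2 * A₁ a) + ∑ F (λ a → 4 * A₂ a + 2 * A₃ a)
      ≡⟨ cong (∑ F (λ a → 2 * A₁ a) +_) (∑-+ F (λ a → 4 * A₂ a) (λ a → 2 * A₃ a)) ⟩
    ∑ F (λ a → 2 * A₁ a) + (∑ F (λ a → 4 * A₂ a) + ∑ F (λ a → 2 * A₃ a))
      ≡⟨ cong₂ _+_ (∑-*ˡ F A₁ 2) (cong₂ _+_ (∑-*ˡ F A₂ 4) (∑-*ˡ F A₃ 2)) ⟩
    2 * ∑ F A₁ + (4 * ∑ F A₂ + 2 * ∑ F A₃)
      ≤⟨ +-mono-≤ (*-monoʳ-≤ 2 (∑-<ᵇ n (suc M)))
           (+-mono-≤ (*-monoʳ-≤ 4 (∑-<ᵇ n (2 + dbl h))) (*-monoʳ-≤ 2 (∑-≡ᵇ n M))) ⟩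
    extra ∎
    where
    open ≤-Reasoning
    F = allFin n
    A₁ A₂ A₃ : Fin n → ℕ
    A₁ a = [ toℕ a <ᵇ suc M ]?
    A₂ a = [ toℕ a <ᵇ 2 + dbl h ]?
    A₃ a = [ toℕ a ≡ᵇ M ]?

  ∑-outs : ∑ W (λ u → length (outs (labelV u))) ≤ n * k + extra
  ∑-outs = begin
    ∑ W (λ u → length (outs (labelV u)))
      ≡⟨ ∑-allV k n _ ⟩
    ∑ (allFin k) (λ i → ∑ (allFin n) (λ a → length (outs (labelV (i , a)))))
      ≤⟨ ∑-mono (allFin k) (λ i → ∑-mono (allFin n) (λ a → outs-label (toℕ i) (toℕ a) (toℕ<n i))) ⟩
    ∑ (allFin k) (λ i → ∑ (allFin n) (λ a → 1 + [ toℕ a <ᵇ suc M ]? * column-share (toℕ i) (toℕ a)))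
      ≡⟨ ∑-swap (allFin k) (allFin n) _ ⟩
    ∑ (allFin n) (λ a → ∑ (allFin k) (λ i → 1 + [ toℕ a <ᵇ suc M ]? * column-share (toℕ i) (toℕ a)))
      ≤⟨ ∑-mono (allFin n) (λ a → column (toℕ a)) ⟩
    ∑ (allFin n) (λ a → k + budget (toℕ a))
      ≡⟨ ∑-+ (allFin n) (λ _ → k) (λ a → budget (toℕ a)) ⟩
    ∑ (allFin n) (λ _ → k) + ∑ (allFin n) (λ a → budget (toℕ a))
      ≤⟨ +-mono-≤ (≤-reflexive (trans (∑-const (allFin n) k) (cong (_* k) (length-allFin n)))) ∑-budget ⟩
    n * k + extra ∎
    where
    open ≤-Reasoning
    scaled : ∀ a → [ a <ᵇ suc M ]? * column-excess a ≤ budget a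
    scaled a with a <? suc M
    ... | yes (s≤s a≤M) = ≤-trans (≤-trans (*-monoˡ-≤ (column-excess a) ([]?≤1 (a <ᵇ suc M)))
                            (≤-reflexive (*-identityˡ (column-excess a)))) (column-excess-≤ a a≤M)
    ... | no a≮ rewrite ≢true⇒≡false {a <ᵇ suc M} (λ e → a≮ (<ᵇ⇒< a (suc M) (≡true⇒T e))) = z≤n
    column : ∀ a → ∑ (allFin k) (λ i → 1 + [ a <ᵇ suc M ]? * column-share (toℕ i) a) ≤ k + budget a
    column a = begin
      ∑ (allFin k) (λ i → 1 + [ a <ᵇ suc M ]? * column-share (toℕ i) a)
        ≡⟨ ∑-+ (allFin k) (λ _ → 1) _ ⟩
      ∑ (allFin k) (λ _ → 1) + ∑ (allFin k) (λ i → [ a <ᵇ suc M ]? * column-share (toℕ i) a)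
        ≡⟨ cong₂ _+_ (trans (∑-const (allFin k) 1) (trans (*-identityʳ _) (length-allFin k)))
             (∑-*ˡ (allFin k) (λ i → column-share (toℕ i) a) [ a <ᵇ suc M ]?) ⟩
      k + [ a <ᵇ suc M ]? * ∑ (allFin k) (λ i → column-share (toℕ i) a)
        ≤⟨ +-monoʳ-≤ k (≤-trans (*-monoʳ-≤ [ a <ᵇ suc M ]? (∑-column-share a)) (scaled a)) ⟩
      k + budget a ∎

  edges-≤ : edgeCount H ≤ n * k + extra
  edges-≤ = begin
    orderedEdgeCount H / 2                       ≤⟨ /-monoˡ-≤ 2 ordered ⟩
    (n * k + extra) * 2 / 2                      ≡⟨ m*n/n≡m (n * k + extra) 2 ⟩
    n * k + extra                                ∎
    where
    open ≤-Reasoning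
    ordered : orderedEdgeCount H ≤ (n * k + extra) * 2
    ordered = begin
      ∑ W (λ u → ∑ W (λ v → [ H u v ]?))
        ≤⟨ ∑-mono W (λ u → ∑-mono W (λ v → ∨-≤-+ (member (labelV v) (outs (labelV u))) _)) ⟩
      ∑ W (λ u → ∑ W (λ v → own u v + own v u))
        ≡⟨ ∑-cong W (λ u → ∑-+ W (own u) (λ v → own v u)) ⟩
      ∑ W (λ u → ∑ W (own u) + ∑ W (λ v → own v u))
        ≡⟨ ∑-+ W (λ u → ∑ W (own u)) (λ u → ∑ W (λ v → own v u)) ⟩
      ∑ W (λ u → ∑ W (own u)) + ∑ W (λ u → ∑ W (λ v → own v u))
        ≡⟨ cong (∑ W (λ u → ∑ W (own u)) +_) (∑-swap W W (λ u v → own v u)) ⟩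
      ∑ W (λ u → ∑ W (own u)) + ∑ W (λ u → ∑ W (own u))
        ≤⟨ +-mono-≤ owned owned ⟩
      (n * k + extra) + (n * k + extra)
        ≡⟨ solve 1 (λ x → x :+ x := x :* con 2) refl (n * k + extra) ⟩
      (n * k + extra) * 2 ∎
      where
      owned : ∑ W (λ u → ∑ W (own u)) ≤ n * k + extra
      owned = ≤-trans (∑-mono W (λ u → count-member (outs (labelV u)))) ∑-outs

-- Choice of the parameters and the final bound.

dbl≡2* : ∀ c → dbl c ≡ 2 * c
dbl≡2* zero    = refl
dbl≡2* (suc c) = trans (cong (suc ∘ suc) (dbl≡2* c)) (cong suc (sym (+-suc c (c + 0))))

halve : ∀ x → Σ ℕ λ m → Σ Bool λ ε → x ≡ [ ε ]? + dbl m
halve zero          = 0 , false , refl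
halve (suc zero)    = 0 , true , refl
halve (suc (suc x)) with halve x
... | m , true  , refl = suc m , true , refl
... | m , false , refl = suc m , false , refl

≤-5*ceil5 : ∀ ℓ → ℓ ≤ 5 * ceil5 ℓ
≤-5*ceil5 ℓ = +-cancelʳ-≤ 4 ℓ _ (begin
  ℓ + 4                              ≡⟨ m≡m%n+[m/n]*n (ℓ + 4) 5 ⟩
  (ℓ + 4) % 5 + ceil5 ℓ * 5          ≤⟨ +-monoˡ-≤ _ (≤-pred (m%n<n (ℓ + 4) 5)) ⟩
  4 + ceil5 ℓ * 5                    ≡⟨ solve 1 (λ c → con 4 :+ c :* con 5 := con 5 :* c :+ con 4) refl (ceil5 ℓ) ⟩
  5 * ceil5 ℓ + 4                    ∎)
  where open ≤-Reasoning

sat-bound : ∀ h ℓ → 60 * (3 + h) + 12 ≤ ℓ →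
            Σ ℕ λ N → (n : ℕ) → N ≤ n → SatLe (3 + h) n ℓ ((3 + h) * (n ∸ 1) + 6 * ceil5 ℓ)
-- With `M = suc m`, the length `suc L` equals 6 plus `dbl m`, plus 1 if `ε`. Hence `m` and `ε` are
-- the half and the parity of `ℓ ∸ 6`.
sat-bound h ℓ ℓ-large with halve (ℓ ∸ 6)
... | m , ε , eq = 2 + m , build
  where
  ℓ≡ : ℓ ≡ 6 + ([ ε ]? + 2 * m)
  ℓ≡ = trans (sym (m+[n∸m]≡n 6≤ℓ)) (cong (6 +_) (trans eq (cong ([ ε ]? +_) (dbl≡2* m))))
    where
    6≤ℓ : 6 ≤ ℓ
    6≤ℓ = ≤-trans (≤-trans (m≤m+n 6 6) (m≤n+m 12 (60 * (3 + h)))) ℓ-large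

  large : 2 + dbl h ≤ m
  large rewrite dbl≡2* h = ≮⇒≥ λ m< → <-irrefl refl (begin-strict
    ℓ                              ≡⟨ ℓ≡ ⟩
    6 + ([ ε ]? + 2 * m)           ≤⟨ +-monoʳ-≤ 6 (+-mono-≤ ([]?≤1 ε) (*-monoʳ-≤ 2 (<⇒≤ m<))) ⟩
    6 + (1 + 2 * (2 + 2 * h))      ≡⟨ solve 1 (λ h → con 6 :+ (con 1 :+ con 2 :* (con 2 :+ con 2 :* h)) := con 11 :+ con 4 :* h) refl h ⟩
    11 + 4 * h                     <⟨ +-mono-<-≤ (m≤m+n 12 180) (*-monoˡ-≤ h (m≤m+n 4 56)) ⟩
    192 + 60 * h                   ≡⟨ solve 1 (λ h → con 192 :+ con 60 :* h := con 60 :* (con 3 :+ h) :+ con 12) refl h ⟩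
    60 * (3 + h) + 12              ≤⟨ ℓ-large ⟩
    ℓ                              ∎)
    where open ≤-Reasoning

  -- Beyond `6 + 2 * m`, which is at most `ℓ`, there remain `8 + 8 * h` edges from `extra` and
  -- `3 + h` from passing to `n ∸ 1`. Five copies of `ceil5 ℓ` pay for `ℓ`, the sixth for this
  -- remainder.
  11+9h≤ : 11 + 9 * h ≤ ceil5 ℓ
  11+9h≤ = *-cancelˡ-≤ 5 (begin
    5 * (11 + 9 * h)               ≡⟨ solve 1 (λ h → con 5 :* (con 11 :+ con 9 :* h) := con 55 :+ con 45 :* h) refl h ⟩
    55 + 45 * h                    ≤⟨ +-mono-≤ (m≤m+n 55 137) (*-monoˡ-≤ h (m≤m+n 45 15)) ⟩
    192 + 60 * h                   ≡⟨ solve 1 (λ h → con 192 :+ con 60 :* h := con 60 :* (con 3 :+ h) :+ con 12) refl h ⟩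
    60 * (3 + h) + 12              ≤⟨ ℓ-large ⟩
    ℓ                              ≤⟨ ≤-5*ceil5 ℓ ⟩
    5 * ceil5 ℓ                    ∎)
    where open ≤-Reasoning

  build : (n : ℕ) → 2 + m ≤ n → SatLe (3 + h) n ℓ ((3 + h) * (n ∸ 1) + 6 * ceil5 ℓ)
  build n@(suc n′) room = subst (λ ℓ′ → SatLe (3 + h) n ℓ′ ((3 + h) * n′ + 6 * ceil5 ℓ)) (sym ℓ≡L)
    (H , (H-spanning , no-cycle , saturated) , ≤-trans edges-≤ few)
    where
    open Construction h m n ε large room using (H; H-spanning; M)
    open NoCycle h m n ε large room using (L; no-cycle)
    open Saturation h m n ε large room using (saturated)
    open EdgeCount h m n ε large room using (edges-≤; extra)
    ℓ≡L : ℓ ≡ suc L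
    ℓ≡L = trans ℓ≡ (trans (solve 2 (λ e m → con 6 :+ (e :+ m) := con 1 :+ (e :+ (con 3 :+ (con 2 :+ m)))) refl [ ε ]? (2 * m))
      (cong (λ x → suc ([ ε ]? + (5 + x))) (sym (dbl≡2* m))))
    few : n * (3 + h) + extra ≤ (3 + h) * n′ + 6 * ceil5 ℓ
    few rewrite dbl≡2* h = begin
      suc n′ * (3 + h) + (2 * (2 + m) + (4 * (2 + 2 * h) + 2 * 1))
        ≡⟨ solve 3 (λ n h m → (con 1 :+ n) :* (con 3 :+ h) :+ (con 2 :* (con 2 :+ m) :+ (con 4 :* (con 2 :+ con 2 :* h) :+ con 2 :* con 1))
             := (con 3 :+ h) :* n :+ ((con 6 :+ (con 0 :+ con 2 :* m)) :+ (con 11 :+ con 9 :* h))) refl n′ h m ⟩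
      (3 + h) * n′ + ((6 + (0 + 2 * m)) + (11 + 9 * h))
        ≤⟨ +-monoʳ-≤ ((3 + h) * n′) (+-mono-≤ (+-monoʳ-≤ 6 (m≤n+m (2 * m) [ ε ]?)) 11+9h≤) ⟩
      (3 + h) * n′ + ((6 + ([ ε ]? + 2 * m)) + ceil5 ℓ)
        ≤⟨ +-monoʳ-≤ ((3 + h) * n′) (+-monoˡ-≤ (ceil5 ℓ) (≤-trans (≤-reflexive (sym ℓ≡)) (≤-5*ceil5 ℓ))) ⟩
      (3 + h) * n′ + (5 * ceil5 ℓ + ceil5 ℓ)
        ≡⟨ cong ((3 + h) * n′ +_) (+-comm (5 * ceil5 ℓ) (ceil5 ℓ)) ⟩
      (3 + h) * n′ + 6 * ceil5 ℓ ∎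
      where open ≤-Reasoning

weaken : ∀ {k n ℓ a b} → a ≤ b → SatLe k n ℓ a → SatLe k n ℓ b
weaken a≤b (H , sat , few) = H , sat , ≤-trans few a≤b

theorem1p10 : ((k ℓ : ℕ) → 4 ≤ k → 60 * k + 12 ≤ ℓ →
    Σ ℕ λ N → (n : ℕ) → N ≤ n → SatLe k n ℓ (k * (n ∸ 1) + 6 * ceil5 ℓ))
    ×
    ((ℓ : ℕ) → 60 * 3 + 12 ≤ ℓ →
    Σ ℕ λ N → (n : ℕ) → N ≤ n → SatLe 3 n ℓ (3 * n + 13 * ceil5 ℓ))
theorem1p10 = many , three
  where
  many : (k ℓ : ℕ) → 4 ≤ k → 60 * k + 12 ≤ ℓ →
         Σ ℕ λ N → (n : ℕ) → N ≤ n → SatLe k n ℓ (k * (n ∸ 1) + 6 * ceil5 ℓ)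
  many (suc (suc (suc h))) ℓ _ ℓ-large = sat-bound h ℓ ℓ-large
  many 2 ℓ (s≤s (s≤s ())) _
  many 1 ℓ (s≤s ()) _
  many 0 ℓ () _
  three : (ℓ : ℕ) → 60 * 3 + 12 ≤ ℓ → Σ ℕ λ N → (n : ℕ) → N ≤ n → SatLe 3 n ℓ (3 * n + 13 * ceil5 ℓ)
  three ℓ ℓ-large with sat-bound 0 ℓ ℓ-large
  ... | N , sat = N , λ n N≤n → weaken
    (+-mono-≤ (*-monoʳ-≤ 3 (m∸n≤m n 1)) (*-monoˡ-≤ (ceil5 ℓ) (m≤m+n 6 7))) (sat n N≤n)
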